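{- The algorithm $\textsc{Universal}$, which for a set $\mathcal{I}$ of $n$ items computes a universal policy for the oblivious knapsack problem, can be implemented to run in time $\Theta(n\log n)$.
   Context: An instance of the oblivious knapsack problem is a finite set $\mathcal{I}$ of $n$ items; each item $i$ has a value $v(i)\in\mathbb{Q}_{\ge 0}$ and a size $l(i)\in\mathbb{Q}_{>0}$. For $S\subseteq\mathcal{I}$ put $v(S)=\sum_{i\in S}v(i)$ and $l(S)=\sum_{i\in S}l(i)$. A universal policy is a permutation of the items (the order in which packing them is attempted). Running time counts elementary operations, with arithmetic operations and comparisons of the input numbers at unit cost. Density order: $d(i)=v(i)/l(i)$. A bijection (tie-breaking index) $t:\mathcal{I}\to\{1,\dots,n\}$ is fixed. Write $\tilde d(i)\succ\tilde d(j)$ iff $d(i)>d(j)$, or $d(i)=d(j)$ and $t(i)>t(j)$. Swap items: for a capacity $C$, let $D=(D_1,D_2,\dots)$ be the items of size at most $C$ sorted decreasingly with respect to $\tilde d$, let $k=\max\{j\mid l(\{D_1,\dots,D_j\})\le C\}$, $P=\{D_1,\dots,D_k\}$, and $s=D_{k+1}$ (if it exists). The algorithm $\textsc{MGreedy}(\mathcal{I},C)$ returns $P$ if $v(P)\ge v(s)$ or if $s$ does not exist, and returns $\{s\}$ otherwise. In the latter case $s$ is called a swap item for capacity $C$. An item is a swap item if it is a swap item for some capacity $C$. Algorithm $\textsc{Universal}(\mathcal{I})$: let $L=(L_1,\dots,L_n)$ be the items sorted by non-decreasing size (ties broken arbitrarily). Start with the empty sequence $\Pi^{(0)}$. For $r=1,\dots,n$: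 if $L_r$ is a swap item, then $\Pi^{(r)}$ is obtained from $\Pi^{(r-1)}$ by inserting $L_r$ at the very front; otherwise $\Pi^{(r)}$ is obtained from $\Pi^{(r-1)}$ by inserting $L_r$ immediately in front of the first item $\Pi^{(r-1)}_j$ for which $\tilde d(\Pi^{(r-1)}_j)\succ\tilde d(L_r)$ does not hold (at the end if there is no such item). The output is $\Pi=\Pi^{(n)}$. -}

module Defs where

open import Data.Fin.Base using (Fin; toℕ)
import Data.Integer.Base as ℤ
open import Data.List.Base
  using (List; []; _∷_; _++_; map; foldr; filter; take; drop; length; allFin; takeWhile; dropWhile)
open import Data.List.Relation.Binary.Permutation.Propositional using (_↭_)
open import Data.List.Relation.Unary.Linked using (Linked)
open import Data.Nat.Base as ℕ using (ℕ; suc)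
import Data.Nat.Properties as ℕ
open import Data.Product.Base using (∃-syntax; _×_)
open import Data.Rational.Base as ℚ using (ℚ; 0ℚ; NonZero; Positive)
open import Data.Rational.Literals using (fromℤ)
import Data.Rational.Properties as ℚ
open import Data.Sum.Base using (_⊎_)
open import Data.Vec.Base as Vec using (Vec)
open import Function.Bundles using (_⤖_; Bijection)
open import Relation.Binary.Core using (Rel)
open import Relation.Binary.Definitions using (Decidable)
open import Relation.Binary.PropositionalEquality.Core using (_≡_)
open import Relation.Nullary.Decidable using (_×-dec_; _⊎-dec_)
open import Relation.Nullary.Negation.Core using (¬_)

------------------------------------------------------------------------
-- The oblivious knapsack problem

record Instance (n : ℕ) : Set where
  field
    v   : Fin n → ℚ
    l   : Fin n → ℚ
    v≥0 : ∀ i → 0ℚ ℚ.≤ v i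
    l>0 : ∀ i → Positive (l i)
    tie : Fin n ⤖ Fin n

  -- Shifted so that the range is {1,…,n}.
  t : Fin n → ℕ
  t i = suc (toℕ (Bijection.to tie i))

  d : Fin n → ℚ
  d i = (v i ℚ.÷ l i) {{ℚ.pos⇒nonZero (l i) {{l>0 i}}}}

  infix 4 _≻_ _≻?_

  _≻_ : Rel (Fin n) _
  i ≻ j = d j ℚ.< d i ⊎ (d i ≡ d j × t j ℕ.< t i)

  _≻?_ : Decidable _≻_
  i ≻? j = (d j ℚ.<? d i) ⊎-dec ((d i ℚ.≟ d j) ×-dec (t j ℕ.<? t i))

IsPolicy : ∀ {n} → List (Fin n) → Set
IsPolicy {n} Π = Π ↭ allFin n

total : ∀ {n} → (Fin n → ℚ) → List (Fin n) → ℚ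
total f = foldr (λ i acc → f i ℚ.+ acc) 0ℚ

module _ {n : ℕ} (I : Instance n) where
  open Instance I

  record IsDensityOrder (C : ℚ) (D : List (Fin n)) : Set where
    field
      items  : D ↭ filter (λ i → l i ℚ.≤? C) (allFin n)
      sorted : Linked _≻_ D

  record IsGreedyLength (C : ℚ) (D : List (Fin n)) (k : ℕ) : Set where
    field
      bounded : k ℕ.≤ length D
      fits    : total l (take k D) ℚ.≤ C
      maximal : ∀ j → j ℕ.≤ length D → total l (take j D) ℚ.≤ C → j ℕ.≤ k

  -- The outcome records which case of MGreedy applied, since a prefix P may
  -- also be a singleton.
  data Outcome : Set where
    prefix : List (Fin n) → Outcome
    swap   : Fin n → Outcome

  data MGreedy (C : ℚ) : Outcome → Set where
    exhausted : ∀ {D k} → IsDensityOrder C D → IsGreedyLength C D k →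
                drop k D ≡ [] →
                MGreedy C (prefix (take k D))
    keep      : ∀ {D k s R} → IsDensityOrder C D → IsGreedyLength C D k →
                drop k D ≡ s ∷ R → v s ℚ.≤ total v (take k D) →
                MGreedy C (prefix (take k D))
    replace   : ∀ {D k s R} → IsDensityOrder C D → IsGreedyLength C D k →
                drop k D ≡ s ∷ R → total v (take k D) ℚ.< v s →
                MGreedy C (swap s)

  IsSwapItem : Fin n → Set
  IsSwapItem s = ∃[ C ] MGreedy C (swap s)

  insert : Fin n → List (Fin n) → List (Fin n)
  insert x Π = takeWhile (_≻? x) Π ++ x ∷ dropWhile (_≻? x) Π

  data Step (x : Fin n) (Π : List (Fin n)) : List (Fin n) → Set where
    front : IsSwapItem x → Step x Π (x ∷ Π)
    place : ¬ IsSwapItem x → Step x Π (insert x Π)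

  -- Steps Π L Π′: starting from Π, processing the items of L from left to
  -- right yields Π′.
  data Steps (Π : List (Fin n)) : List (Fin n) → List (Fin n) → Set where
    done : Steps Π [] Π
    step : ∀ {x L Π′ Π″} → Step x Π Π′ → Steps Π′ L Π″ → Steps Π (x ∷ L) Π″

  -- A relation rather than a function: the ties in L are broken arbitrarily.
  Universal : List (Fin n) → Set
  Universal Π = ∃[ L ] L ↭ allFin n × Linked (λ i j → l i ℚ.≤ l j) L × Steps [] L Π

------------------------------------------------------------------------
-- Elementary operations
--
-- Algorithms are finite programs, fixed independently of the input, in a
-- first-order language over rationals and immutable cells.  Each evaluated
-- construct (variable access, constant, arithmetic operation, comparison,
-- cell allocation, case distinction, binding, procedure call) costs one unit.
-- Values are shared, so binding or passing one is copying a pointer, and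
-- environments have size bounded by the program text; hence each unit is a
-- constant number of operations of a random access machine.

data Value : Set where
  num  : ℚ → Value
  nil  : Value
  cons : Value → Value → Value

data Op : Set where
  add sub mul : Op

⟦_⟧ : Op → ℚ → ℚ → ℚ
⟦ add ⟧ = ℚ._+_
⟦ sub ⟧ = ℚ._-_
⟦ mul ⟧ = ℚ._*_

-- F is the number of procedures, Γ the number of variables in scope.
data Exp (F Γ : ℕ) : Set where
  var     : Fin Γ → Exp F Γ
  const   : ℚ → Exp F Γ
  arith   : Op → Exp F Γ → Exp F Γ → Exp F Γ
  div     : Exp F Γ → Exp F Γ → Exp F Γ
  if_≤_then_else_ : Exp F Γ → Exp F Γ → Exp F Γ → Exp F Γ → Exp F Γ
  nil     : Exp F Γ
  cons    : Exp F Γ → Exp F Γ → Exp F Γ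
  -- The second branch binds the head (index 0) and the tail (index 1).
  case    : Exp F Γ → Exp F Γ → Exp F (2 ℕ.+ Γ) → Exp F Γ
  let′    : Exp F Γ → Exp F (suc Γ) → Exp F Γ
  call    : Fin F → Exp F Γ → Exp F Γ

-- Procedures are mutually recursive and take one argument.
record Program : Set where
  field
    size : ℕ
    body : Vec (Exp size 1) size
    main : Exp size 1

open Program

Env : ℕ → Set
Env = Vec Value

infix 3 _,_⊢_⇓_[_]

-- p , ρ ⊢ e ⇓ w [ c ]: in the program p and environment ρ, the expression e
-- evaluates to w at cost c.  Division by zero and applying an operation to a
-- value of the wrong shape have no result.
data _,_⊢_⇓_[_] (p : Program) {Γ : ℕ} (ρ : Env Γ) : Exp (size p) Γ → Value → ℕ → Set where

  var   : ∀ {x} → p , ρ ⊢ var x ⇓ Vec.lookup ρ x [ 1 ]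

  const : ∀ {q} → p , ρ ⊢ const q ⇓ num q [ 1 ]

  arith : ∀ {o e₁ e₂ q₁ q₂ c₁ c₂} →
          p , ρ ⊢ e₁ ⇓ num q₁ [ c₁ ] →
          p , ρ ⊢ e₂ ⇓ num q₂ [ c₂ ] →
          p , ρ ⊢ arith o e₁ e₂ ⇓ num (⟦ o ⟧ q₁ q₂) [ suc (c₁ ℕ.+ c₂) ]

  div   : ∀ {e₁ e₂ q₁ q₂ c₁ c₂} .{{_ : NonZero q₂}} →
          p , ρ ⊢ e₁ ⇓ num q₁ [ c₁ ] →
          p , ρ ⊢ e₂ ⇓ num q₂ [ c₂ ] →
          p , ρ ⊢ div e₁ e₂ ⇓ num (q₁ ℚ.÷ q₂) [ suc (c₁ ℕ.+ c₂) ]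

  if-≤  : ∀ {e₁ e₂ e₃ e₄ q₁ q₂ w c₁ c₂ c₃} →
          p , ρ ⊢ e₁ ⇓ num q₁ [ c₁ ] →
          p , ρ ⊢ e₂ ⇓ num q₂ [ c₂ ] →
          q₁ ℚ.≤ q₂ →
          p , ρ ⊢ e₃ ⇓ w [ c₃ ] →
          p , ρ ⊢ if e₁ ≤ e₂ then e₃ else e₄ ⇓ w [ suc (c₁ ℕ.+ c₂ ℕ.+ c₃) ]

  if-≰  : ∀ {e₁ e₂ e₃ e₄ q₁ q₂ w c₁ c₂ c₄} →
          p , ρ ⊢ e₁ ⇓ num q₁ [ c₁ ] →
          p , ρ ⊢ e₂ ⇓ num q₂ [ c₂ ] →
          ¬ (q₁ ℚ.≤ q₂) →
          p , ρ ⊢ e₄ ⇓ w [ c₄ ] →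
          p , ρ ⊢ if e₁ ≤ e₂ then e₃ else e₄ ⇓ w [ suc (c₁ ℕ.+ c₂ ℕ.+ c₄) ]

  nil   : p , ρ ⊢ nil ⇓ nil [ 1 ]

  cons  : ∀ {e₁ e₂ w₁ w₂ c₁ c₂} →
          p , ρ ⊢ e₁ ⇓ w₁ [ c₁ ] →
          p , ρ ⊢ e₂ ⇓ w₂ [ c₂ ] →
          p , ρ ⊢ cons e₁ e₂ ⇓ cons w₁ w₂ [ suc (c₁ ℕ.+ c₂) ]

  case-nil  : ∀ {e₁ e₂ e₃ w c₁ c₂} →
              p , ρ ⊢ e₁ ⇓ nil [ c₁ ] →
              p , ρ ⊢ e₂ ⇓ w [ c₂ ] →
              p , ρ ⊢ case e₁ e₂ e₃ ⇓ w [ suc (c₁ ℕ.+ c₂) ]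

  case-cons : ∀ {e₁ e₂ e₃ w₁ w₂ w c₁ c₃} →
              p , ρ ⊢ e₁ ⇓ cons w₁ w₂ [ c₁ ] →
              p , (w₁ Vec.∷ w₂ Vec.∷ ρ) ⊢ e₃ ⇓ w [ c₃ ] →
              p , ρ ⊢ case e₁ e₂ e₃ ⇓ w [ suc (c₁ ℕ.+ c₃) ]

  let′  : ∀ {e₁ e₂ w₁ w c₁ c₂} →
          p , ρ ⊢ e₁ ⇓ w₁ [ c₁ ] →
          p , (w₁ Vec.∷ ρ) ⊢ e₂ ⇓ w [ c₂ ] →
          p , ρ ⊢ let′ e₁ e₂ ⇓ w [ suc (c₁ ℕ.+ c₂) ]

  call  : ∀ {f e u w c₁ c₂} →
          p , ρ ⊢ e ⇓ u [ c₁ ] →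
          p , (u Vec.∷ Vec.[]) ⊢ Vec.lookup (body p) f ⇓ w [ c₂ ] →
          p , ρ ⊢ call f e ⇓ w [ suc (c₁ ℕ.+ c₂) ]

------------------------------------------------------------------------
-- Implementations and their running time

fromℕ : ℕ → ℚ
fromℕ m = fromℤ (ℤ.+ m)

list : List Value → Value
list = foldr cons nil

index : ∀ {n} → Fin n → Value
index i = num (fromℕ (toℕ i))

-- The input is the list of the records (index, value, size, tie-breaking
-- index) of the items.
encodeInstance : ∀ {n} → Instance n → Value
encodeInstance {n} I = list (map item (allFin n))
  where
  open Instance I
  item : Fin n → Value
  item i = cons (index i) (cons (num (v i)) (cons (num (l i)) (num (fromℕ (t i)))))

encodePolicy : ∀ {n} → List (Fin n) → Value
encodePolicy Π = list (map index Π)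

-- Run p I w T: on the instance I, the program p outputs w in time T.
Run : ∀ {n} → Program → Instance n → Value → ℕ → Set
Run p I w T = p , (encodeInstance I Vec.∷ Vec.[]) ⊢ main p ⇓ w [ T ]

ImplementsUniversal : Program → Set
ImplementsUniversal p = ∀ n (I : Instance n) →
  ∃[ Π ] ∃[ T ] Run p I (encodePolicy Π) T × IsPolicy Π × Universal I Π

-- The worst-case running time over the instances with n items is Θ(g n).
-- The maximum over instances is unfolded: at most b * g n means that every
-- run is, at least g n / a means that some run is.  For g unbounded, the
-- constants a and b are necessarily positive.
RunsInΘ : Program → (ℕ → ℕ) → Set
RunsInΘ p g = ∃[ a ] ∃[ b ] ∃[ n₀ ] ∀ n → n₀ ℕ.≤ n →
  (∀ (I : Instance n) w T → Run p I w T → T ℕ.≤ b ℕ.* g n) ×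
  (∃[ I ] ∃[ w ] ∃[ T ] Run {n} p I w T × g n ℕ.≤ a ℕ.* T)

{-# OPTIONS --safe #-}

-- An item s is a swap item iff the items that precede s in the density order
-- and are not larger than s have a total value w with 0 < w < v s: being
-- denser and cheaper than s, they are also smaller in total, so that a
-- capacity beyond l s adds no further item to them.  The numbers w are found
-- by a stable merge sort by size of the density order, where a merge adds to
-- the weight of each item of the right block the value of the items of the
-- left block that are emitted before it.
--
-- A block of consecutive insertions, with or without swap items, acts on a
-- sequence X as X ↦ H ++ merge X B, where H and B depend on the block only.
-- It is therefore represented by its effect H ++ marker ∷ B on a marker that
-- precedes every item, and two blocks are composed in linear time.  Thus the
-- insertions, and the sorting by density as the case without swap items, are
-- done by pairing up adjacent blocks ⌈log₂ n⌉ times.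

module Submission where

open import Defs
open import Data.Nat.Base using (_*_)
open import Data.Nat.Logarithm using (⌊log₂_⌋)
open import Data.Product.Base using (∃-syntax; _×_)

open import Data.Bool.Base using (Bool; true; false; _∧_) renaming (if_then_else_ to ifᵇ_then_else_)
open import Data.Fin.Base using (Fin)
open import Data.Fin using (#_)
import Data.Fin.Properties as Fin
import Data.Integer.Base as ℤ
import Data.Integer.Properties as ℤ
open import Data.List.Base
  using (List; []; _∷_; [_]; _++_; map; length; allFin; filter; take; drop; catMaybes; concat)
open import Data.List.Properties
  using (length-++; length-++-≤ˡ; length-map; length-tabulate; ++-assoc; ++-identityʳ; filter-++; filter-all; filter-none;
         filter-accept; filter-reject; take++drop≡id; concat-map-[_])
open import Data.List.Membership.Propositional using (_∈_)
open import Data.List.Membership.Propositional.Properties using (∈-∃++; ∈-filter⁺; ∈-filter⁻; ∈-allFin; ∈-++⁺ʳ)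
open import Data.List.Relation.Binary.Permutation.Propositional as Perm
  using (_↭_; ↭-sym; ↭-trans; ↭-refl; prep; ↭⇒↭ₛ)
open import Data.List.Relation.Binary.Permutation.Propositional.Properties
  using (filter-↭; All-resp-↭; ∈-resp-↭; ++⁺; shift; catMaybes-↭; ↭-length)
open import Data.List.Relation.Binary.Permutation.Setoid.Properties using (Unique-resp-↭)
open import Data.List.Relation.Binary.Pointwise.Base using (Pointwise; []; _∷_)
open import Data.List.Relation.Unary.All as All using (All; []; _∷_)
import Data.List.Relation.Unary.All.Properties as All
open import Data.List.Relation.Unary.AllPairs as AllPairs using (AllPairs; []; _∷_)
import Data.List.Relation.Unary.AllPairs.Properties as AllPairs
open import Data.List.Relation.Unary.Any using (here; there)
open import Data.List.Relation.Unary.Linked using (Linked)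
open import Data.List.Relation.Unary.Linked.Properties using (AllPairs⇒Linked; Linked⇒AllPairs)
open import Data.List.Relation.Unary.Unique.Propositional.Properties using (allFin⁺)
open import Data.Maybe.Base using (Maybe; just; nothing)
open import Data.Nat.Base as ℕ using (ℕ; zero; suc; _+_; _≤_; _<_; z≤n; s≤s; ⌈_/2⌉; ⌊_/2⌋)
open import Data.Nat.Induction using (<-wellFounded)
open import Data.Nat.Logarithm
  using (⌈log₂_⌉; ⌈log₂⌉-mono-≤; ⌈log₂⌈n/2⌉⌉≡⌈log₂n⌉∸1; ⌊log₂⌋-mono-≤; ⌊log₂⌊n/2⌋⌋≡⌊log₂n⌋∸1)
open import Data.Nat.Properties as ℕ
  using (≤-refl; ≤-trans; ≤-reflexive; ≤ᵇ⇒≤; +-monoˡ-≤; +-monoʳ-≤; +-suc; +-assoc; +-comm; *-suc; m≤n+m; m≤m+n; n≤1+n)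
open import Data.Nat.Tactic.RingSolver using (solve-∀)
open import Data.Product.Base using (_,_; proj₁; proj₂)
open import Data.Rational.Base as ℚ using (ℚ; 0ℚ; 1ℚ)
import Data.Rational.Properties as ℚ
open import Data.Sum.Base using (inj₁; inj₂; [_,_]′)
open import Data.Unit.Base using (tt)
open import Data.Vec.Base as Vec using ([]; _∷_)
open import Function.Base using (_∘_)
open import Function.Bundles using (Bijection)
open import Function.Construct.Identity using (⤖-id)
open import Induction.WellFounded using (Acc; acc)
open import Relation.Binary.Definitions using (tri<; tri≈; tri>)
open import Relation.Binary.PropositionalEquality
  using (_≡_; _≢_; refl; sym; trans; cong; cong₂; subst; subst₂; setoid; module ≡-Reasoning)
open import Relation.Nullary.Decidable using (Dec; does; proof; yes; no; dec-true; dec-false; map′; _×-dec_)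
open import Relation.Nullary.Reflects using (Reflects; ofʸ; ofⁿ)
open import Relation.Nullary.Negation.Core using (¬_; contradiction)
open import Relation.Unary using (Decidable)

-- Swap items

AllPairs-++⁻ : ∀ {A : Set} {R : A → A → Set} xs {ys} → AllPairs R (xs ++ ys) →
               AllPairs R xs × AllPairs R ys × All (λ x → All (R x) ys) xs
AllPairs-++⁻ []       rs       = [] , rs , []
AllPairs-++⁻ (x ∷ xs) (r ∷ rs) =
  let p , q , s = AllPairs-++⁻ xs rs in All.++⁻ˡ xs r ∷ p , q , All.++⁻ʳ xs r ∷ s

filter-filter-cong : ∀ {A : Set} {P Q R : A → Set} (P? : Decidable P) (Q? : Decidable Q) (R? : Decidable R) →
                     (∀ x → P x → (Q x → R x) × (R x → Q x)) →
                     ∀ xs → filter P? (filter Q? xs) ≡ filter P? (filter R? xs)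
filter-filter-cong P? Q? R? Q⇔R [] = refl
filter-filter-cong P? Q? R? Q⇔R (x ∷ xs) with ih ← filter-filter-cong P? Q? R? Q⇔R xs | Q? x | R? x
... | no _  | no _  = ih
... | yes q | no ¬r = trans (filter-reject P? (λ p → ¬r (proj₁ (Q⇔R x p) q))) ih
... | no ¬q | yes r = trans ih (sym (filter-reject P? (λ p → ¬q (proj₂ (Q⇔R x p) r))))
... | yes _ | yes _ with P? x
...   | yes _ = cong (x ∷_) ih
...   | no _  = ih

take-length-++ : ∀ {A : Set} (xs ys : List A) → take (length xs) (xs ++ ys) ≡ xs
take-length-++ []       ys = refl
take-length-++ (x ∷ xs) ys = cong (x ∷_) (take-length-++ xs ys)

drop-length-++ : ∀ {A : Set} (xs ys : List A) → drop (length xs) (xs ++ ys) ≡ ys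
drop-length-++ []       ys = refl
drop-length-++ (x ∷ xs) ys = drop-length-++ xs ys

take-beyond : ∀ {A : Set} xs {y : A} {ys j} → length xs ℕ.< j →
              ∃[ zs ] take j (xs ++ y ∷ ys) ≡ xs ++ y ∷ zs
take-beyond []       (s≤s _) = _ , refl
take-beyond (x ∷ xs) (s≤s h) = let zs , eq = take-beyond xs h in zs , cong (x ∷_) eq

module _ {n : ℕ} where

  total-++ : ∀ (f : Fin n → ℚ) xs ys → total f (xs ++ ys) ≡ total f xs ℚ.+ total f ys
  total-++ f []       ys = sym (ℚ.+-identityˡ _)
  total-++ f (x ∷ xs) ys = trans (cong (f x ℚ.+_) (total-++ f xs ys)) (sym (ℚ.+-assoc (f x) _ _))

  total-↭ : ∀ (f : Fin n → ℚ) {xs ys} → xs ↭ ys → total f xs ≡ total f ys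
  total-↭ f Perm.refl = refl
  total-↭ f (prep x p) = cong (f x ℚ.+_) (total-↭ f p)
  total-↭ f (Perm.swap {xs} {ys} x y p) =
    trans (sym (ℚ.+-assoc (f x) (f y) _))
      (trans (cong₂ ℚ._+_ (ℚ.+-comm (f x) (f y)) (total-↭ f p)) (ℚ.+-assoc (f y) (f x) _))
  total-↭ f (Perm.trans p q) = trans (total-↭ f p) (total-↭ f q)

  total-≥0 : ∀ (f : Fin n → ℚ) → (∀ i → 0ℚ ℚ.≤ f i) → ∀ xs → 0ℚ ℚ.≤ total f xs
  total-≥0 f f≥0 []       = ℚ.≤-refl
  total-≥0 f f≥0 (x ∷ xs) = ℚ.+-mono-≤ (f≥0 x) (total-≥0 f f≥0 xs)

  total-∈ : ∀ (f : Fin n → ℚ) → (∀ i → 0ℚ ℚ.≤ f i) → ∀ {i xs} → i ∈ xs → f i ℚ.≤ total f xs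
  total-∈ f f≥0 {i} {_ ∷ xs} (here refl) =
    subst (ℚ._≤ total f (i ∷ xs)) (ℚ.+-identityʳ (f i)) (ℚ.+-monoʳ-≤ (f i) (total-≥0 f f≥0 xs))
  total-∈ f f≥0 {i} {x ∷ xs} (there i∈) =
    subst (ℚ._≤ total f (x ∷ xs)) (ℚ.+-identityˡ (f i)) (ℚ.+-mono-≤ (f≥0 x) (total-∈ f f≥0 i∈))

-- The density order and the criterion for swap items.

module Density {n : ℕ} (I : Instance n) where
  open Instance I

  t-injective : ∀ {i j} → t i ≡ t j → i ≡ j
  t-injective eq = Bijection.injective tie (Fin.toℕ-injective (ℕ.suc-injective eq))

  ≻-trans : ∀ {i j k} → i ≻ j → j ≻ k → i ≻ k
  ≻-trans (inj₁ p)       (inj₁ q)       = inj₁ (ℚ.<-trans q p)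
  ≻-trans (inj₁ p)       (inj₂ (e , _)) = inj₁ (subst (ℚ._< _) e p)
  ≻-trans (inj₂ (e , _)) (inj₁ q)       = inj₁ (subst (_ ℚ.<_) (sym e) q)
  ≻-trans (inj₂ (e , p)) (inj₂ (f , q)) = inj₂ (trans e f , ℕ.<-trans q p)

  ≻-irrefl : ∀ {i} → ¬ i ≻ i
  ≻-irrefl (inj₁ p)       = ℚ.<-irrefl refl p
  ≻-irrefl (inj₂ (_ , p)) = ℕ.<-irrefl refl p

  -- Items of equal density are separated by their tie-breaking indices, because `tie` is injective.
  ≻-connex : ∀ {i j} → i ≢ j → ¬ i ≻ j → j ≻ i
  ≻-connex {i} {j} i≢j i⊁j with ℚ.<-cmp (d i) (d j)
  ... | tri< di<dj _ _ = inj₁ di<dj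
  ... | tri> _ _ dj<di = contradiction (inj₁ dj<di) i⊁j
  ... | tri≈ _ di≡dj _ with ℕ.<-cmp (t i) (t j)
  ...   | tri< ti<tj _ _ = inj₂ (sym di≡dj , ti<tj)
  ...   | tri≈ _ ti≡tj _ = contradiction (t-injective ti≡tj) i≢j
  ...   | tri> _ _ tj<ti = contradiction (inj₂ (di≡dj , tj<ti)) i⊁j

  -- A strict total order is also negatively transitive. This serves the insertions, which stop at
  -- an item that fails to precede the new one.
  ≻-⊁-trans : ∀ {i j k} → i ≻ k → ¬ j ≻ k → i ≻ j
  ≻-⊁-trans {i} {j} {k} i≻k j⊁k with j Fin.≟ k
  ... | yes refl = i≻k
  ... | no j≢k   = ≻-trans i≻k (≻-connex j≢k j⊁k)

  l≥0 : ∀ i → 0ℚ ℚ.≤ l i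
  l≥0 i = ℚ.<⇒≤ (ℚ.positive⁻¹ (l i) {{l>0 i}})

  d*l≡v : ∀ i → d i ℚ.* l i ≡ v i
  d*l≡v i = trans (ℚ.*-assoc (v i) _ (l i)) (trans (cong (v i ℚ.*_) (ℚ.*-inverseˡ (l i))) (ℚ.*-identityʳ (v i)))
    where instance _ = ℚ.pos⇒nonZero (l i) {{l>0 i}}

  ≻⇒d≤ : ∀ {i s} → i ≻ s → d s ℚ.≤ d i
  ≻⇒d≤ (inj₁ p)       = ℚ.<⇒≤ p
  ≻⇒d≤ (inj₂ (e , _)) = ℚ.≤-reflexive (sym e)

  -- The inequality of densities, cleared of denominators so that it can be summed over items.
  ≻⇒cross-≤ : ∀ {i s} → i ≻ s → v s ℚ.* l i ℚ.≤ v i ℚ.* l s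
  ≻⇒cross-≤ {i} {s} i≻s = begin
    v s ℚ.* l i           ≡⟨ cong (ℚ._* l i) (d*l≡v s) ⟨
    d s ℚ.* l s ℚ.* l i   ≤⟨ ℚ.*-monoʳ-≤-nonNeg (l i) {{ℚ.nonNegative (l≥0 i)}}
                               (ℚ.*-monoʳ-≤-nonNeg (l s) {{ℚ.nonNegative (l≥0 s)}} (≻⇒d≤ i≻s)) ⟩
    d i ℚ.* l s ℚ.* l i   ≡⟨ ℚ.*-assoc (d i) (l s) (l i) ⟩
    d i ℚ.* (l s ℚ.* l i) ≡⟨ cong (d i ℚ.*_) (ℚ.*-comm (l s) (l i)) ⟩
    d i ℚ.* (l i ℚ.* l s) ≡⟨ ℚ.*-assoc (d i) (l i) (l s) ⟨
    d i ℚ.* l i ℚ.* l s   ≡⟨ cong (ℚ._* l s) (d*l≡v i) ⟩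
    v i ℚ.* l s           ∎
    where open ℚ.≤-Reasoning

  -- Summing the cross-multiplied inequalities: items denser than `s` are, taken together, at least
  -- as dense as `s`. The product form also covers the empty list.
  total-cross-≤ : ∀ {s P} → All (_≻ s) P → v s ℚ.* total l P ℚ.≤ total v P ℚ.* l s
  total-cross-≤ {s} []            = ℚ.≤-reflexive (trans (ℚ.*-zeroʳ (v s)) (sym (ℚ.*-zeroˡ (l s))))
  total-cross-≤ {s} {i ∷ P} (i≻s ∷ P≻s) = begin
    v s ℚ.* (l i ℚ.+ total l P)               ≡⟨ ℚ.*-distribˡ-+ (v s) (l i) _ ⟩
    v s ℚ.* l i ℚ.+ v s ℚ.* total l P         ≤⟨ ℚ.+-mono-≤ (≻⇒cross-≤ i≻s) (total-cross-≤ P≻s) ⟩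
    v i ℚ.* l s ℚ.+ total v P ℚ.* l s         ≡⟨ ℚ.*-distribʳ-+ (l s) (v i) _ ⟨
    (v i ℚ.+ total v P) ℚ.* l s               ∎
    where open ℚ.≤-Reasoning

  -- v(s) l(P) ≤ v(P) l(s) < v(s) l(s), and the factor v(s) cancels.
  cheaper⇒smaller : ∀ {s P} → All (_≻ s) P → total v P ℚ.< v s → total l P ℚ.< l s
  cheaper⇒smaller {s} {P} P≻s vP<vs = ℚ.*-cancelˡ-<-nonNeg (v s) {{ℚ.nonNegative (v≥0 s)}}
    (ℚ.≤-<-trans (total-cross-≤ P≻s) (ℚ.*-monoˡ-<-pos (l s) {{l>0 s}} vP<vs))

  total-l>0 : ∀ {i P} → i ∈ P → 0ℚ ℚ.< total l P
  total-l>0 {i} i∈P = ℚ.<-≤-trans (ℚ.positive⁻¹ (l i) {{l>0 i}}) (total-∈ l l≥0 i∈P)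

  -- The same inequality read from its other end: 0 < v(s) l(P) ≤ v(P) l(s).
  total-v>0 : ∀ {s i P} → All (_≻ s) P → i ∈ P → 0ℚ ℚ.< v s → 0ℚ ℚ.< total v P
  total-v>0 {s} {i} {P} P≻s i∈P 0<vs = ℚ.*-cancelʳ-<-nonNeg (l s) {{ℚ.nonNegative (l≥0 s)}} (begin-strict
    0ℚ ℚ.* l s           ≡⟨ trans (ℚ.*-zeroˡ (l s)) (sym (ℚ.*-zeroʳ (v s))) ⟩
    v s ℚ.* 0ℚ           <⟨ ℚ.*-monoʳ-<-pos (v s) {{ℚ.positive 0<vs}} (total-l>0 i∈P) ⟩
    v s ℚ.* total l P    ≤⟨ total-cross-≤ P≻s ⟩
    total v P ℚ.* l s    ∎)
    where open ℚ.≤-Reasoning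

  -- The number w of the criterion, relative to a list `S` so that it can be accumulated block by
  -- block.
  precedingValue : List (Fin n) → Fin n → ℚ
  precedingValue S i = total v (filter (_≻? i) (filter (λ j → l j ℚ.≤? l i) S))

  precedingValue-++ : ∀ R S i → precedingValue (R ++ S) i ≡ precedingValue R i ℚ.+ precedingValue S i
  precedingValue-++ R S i = trans
    (cong (total v) (trans (cong (filter (_≻? i)) (filter-++ light? R S)) (filter-++ (_≻? i) (filter light? R) _)))
    (total-++ v (filter (_≻? i) (filter light? R)) _)
    where light? = λ j → l j ℚ.≤? l i

  split-≻ : ∀ P {s R} → AllPairs _≻_ (P ++ s ∷ R) → filter (_≻? s) (P ++ s ∷ R) ≡ P
  split-≻ P {s} {R} sorted with AllPairs-++⁻ P sorted
  ... | _ , s≻R ∷ _ , P≻ = begin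
    filter (_≻? s) (P ++ s ∷ R)                   ≡⟨ filter-++ (_≻? s) P (s ∷ R) ⟩
    filter (_≻? s) P ++ filter (_≻? s) (s ∷ R)    ≡⟨ cong₂ _++_ (filter-all (_≻? s) (All.map All.head P≻)) (filter-none (_≻? s) (≻-irrefl ∷ All.map (λ s≻r r≻s → ≻-irrefl (≻-trans s≻r r≻s)) s≻R)) ⟩
    P ++ []                                       ≡⟨ ++-identityʳ P ⟩
    P                                             ∎
    where open ≡-Reasoning

  swapItem⁺ : ∀ {D s} → D ↭ allFin n → AllPairs _≻_ D →
              0ℚ ℚ.< precedingValue D s → precedingValue D s ℚ.< v s → IsSwapItem I s
  swapItem⁺ {D} {s} D↭ sorted 0<w w<v
    with P , R , eq ← ∈-∃++ (∈-filter⁺ (λ j → l j ℚ.≤? l s) (∈-resp-↭ (↭-sym D↭) (∈-allFin s)) (ℚ.≤-refl {l s})) =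
    -- The witnessing capacity is `l s`: `P` fits, being smaller than `s`, and adding `s` exceeds
    -- the capacity because `P` has positive size.
    l s , replace {D = P ++ s ∷ R} {k = length P} order greedy (drop-length-++ P (s ∷ R))
            (subst (λ Q → total v Q ℚ.< v s) (sym (take-length-++ P (s ∷ R))) vP<vs)
    where
    fits? = λ j → l j ℚ.≤? l s

    sorted′ : AllPairs _≻_ (P ++ s ∷ R)
    sorted′ = subst (AllPairs _≻_) eq (AllPairs.filter⁺ fits? sorted)

    w≡vP : precedingValue D s ≡ total v P
    w≡vP = cong (total v) (trans (cong (filter (_≻? s)) eq) (split-≻ P sorted′))

    vP<vs : total v P ℚ.< v s
    vP<vs = subst (ℚ._< v s) w≡vP w<v

    P≻s : All (_≻ s) P
    P≻s = All.map All.head (proj₂ (proj₂ (AllPairs-++⁻ P sorted′)))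

    order : IsDensityOrder I (l s) (P ++ s ∷ R)
    order = record
      { items  = subst (_↭ _) eq (filter-↭ fits? D↭)
      ; sorted = AllPairs⇒Linked sorted′
      }

    -- A positive value excludes the empty list, and every item has positive size.
    0<lP : ∀ Q → 0ℚ ℚ.< total v Q → 0ℚ ℚ.< total l Q
    0<lP []      0<0 = contradiction 0<0 (ℚ.<-irrefl refl)
    0<lP (i ∷ Q) _   = total-l>0 {P = i ∷ Q} (here refl)

    greedy : IsGreedyLength I (l s) (P ++ s ∷ R) (length P)
    greedy = record
      { bounded = length-++-≤ˡ P
      ; fits    = subst (λ Q → total l Q ℚ.≤ l s) (sym (take-length-++ P (s ∷ R))) (ℚ.<⇒≤ (cheaper⇒smaller P≻s vP<vs))
      ; maximal = λ j _ fits → ℕ.≮⇒≥ λ |P|<j → ℚ.<-irrefl refl (ℚ.<-≤-trans (overfull |P|<j) fits)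
      }
      where
      -- A prefix longer than `P` contains all of `P` and also `s`.
      overfull : ∀ {j} → length P ℕ.< j → l s ℚ.< total l (take j (P ++ s ∷ R))
      overfull {j} |P|<j with zs , eq′ ← take-beyond P |P|<j = begin-strict
        l s                                 ≡⟨ ℚ.+-identityˡ (l s) ⟨
        0ℚ ℚ.+ l s                          <⟨ ℚ.+-mono-<-≤ (0<lP P (subst (0ℚ ℚ.<_) w≡vP 0<w)) (total-∈ l l≥0 {xs = s ∷ zs} (here refl)) ⟩
        total l P ℚ.+ total l (s ∷ zs)      ≡⟨ total-++ l P (s ∷ zs) ⟨
        total l (P ++ s ∷ zs)               ≡⟨ cong (total l) eq′ ⟨
        total l (take j (P ++ s ∷ R))       ∎
        where open ℚ.≤-Reasoning

  -- Since P is denser than s and cheaper, it is also smaller than s; so no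
  -- capacity above l s changes the items of size at most C preceding s.
  swapItem⁻ : ∀ {D s} → D ↭ allFin n → IsSwapItem I s →
              0ℚ ℚ.< precedingValue D s × precedingValue D s ℚ.< v s
  swapItem⁻ {D₀} {s} D₀↭ (C , replace {D} {k} {_} {R} order greedy eq vP<vs) =
    subst (0ℚ ℚ.<_) (sym w≡vP) 0<vP , subst (ℚ._< v s) (sym w≡vP) vP<vs
    where
    open IsDensityOrder order
    open IsGreedyLength greedy
    P = take k D

    D≡ : D ≡ P ++ s ∷ R
    D≡ = trans (sym (take++drop≡id k D)) (cong (P ++_) eq)

    sorted′ : AllPairs _≻_ (P ++ s ∷ R)
    sorted′ = subst (AllPairs _≻_) D≡ (Linked⇒AllPairs ≻-trans sorted)

    P≻s : All (_≻ s) P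
    P≻s = All.map All.head (proj₂ (proj₂ (AllPairs-++⁻ P sorted′)))

    filter≡P : filter (_≻? s) D ≡ P
    filter≡P = trans (cong (filter (_≻? s)) D≡) (split-≻ P sorted′)

    s∈D : s ∈ D
    s∈D = subst (s ∈_) (sym D≡) (∈-++⁺ʳ P (here refl))

    ls≤C : l s ℚ.≤ C
    ls≤C = proj₂ (∈-filter⁻ (λ j → l j ℚ.≤? C) {xs = allFin n} (∈-resp-↭ items s∈D))

    small : ∀ j → j ≻ s → l j ℚ.≤ C → l j ℚ.≤ l s
    small j j≻s lj≤C = ℚ.≤-trans (total-∈ l l≥0 j∈P) (ℚ.<⇒≤ (cheaper⇒smaller P≻s vP<vs))
      where
      j∈P : j ∈ P
      j∈P = subst (j ∈_) filter≡P (∈-filter⁺ (_≻? s) (∈-resp-↭ (↭-sym items) (∈-filter⁺ (λ j → l j ℚ.≤? C) (∈-allFin j) lj≤C)) j≻s)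

    -- Among the items preceding `s`, the size bounds `l s` and `C` select the same ones; what
    -- remains is a reordering of `D₀` into `D`.
    w≡vP : precedingValue D₀ s ≡ total v P
    w≡vP = trans
      (cong (total v) (filter-filter-cong (_≻? s) (λ j → l j ℚ.≤? l s) (λ j → l j ℚ.≤? C)
        (λ j j≻s → (λ lj≤ls → ℚ.≤-trans lj≤ls ls≤C) , small j j≻s) D₀))
      (trans (total-↭ v (filter-↭ (_≻? s) (↭-trans (filter-↭ (λ j → l j ℚ.≤? C) D₀↭) (↭-sym items))))
        (cong (total v) filter≡P))

    0<vs : 0ℚ ℚ.< v s
    0<vs = ℚ.≤-<-trans (total-≥0 v v≥0 P) vP<vs

    -- If `k` were zero, `s` would be the first item of `D`; since `s` alone fits into `C`, the
    -- prefix of length 1 would contradict maximality.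
    nonempty : ∀ D k → (∀ j → j ℕ.≤ length D → total l (take j D) ℚ.≤ C → j ℕ.≤ k) →
               drop k D ≡ s ∷ R → ∃[ i ] i ∈ take k D
    nonempty D       zero    max refl with () ← max 1 (s≤s z≤n) (subst (ℚ._≤ C) (sym (ℚ.+-identityʳ (l s))) ls≤C)
    nonempty (i ∷ _) (suc k) max eq   = i , here refl

    0<vP : 0ℚ ℚ.< total v P
    0<vP = total-v>0 P≻s (proj₂ (nonempty D k maximal eq)) 0<vs

-- The program

open Program

-- The upper bound speaks of every run, whereas only one run is constructed; determinism identifies
-- the two.
⇓-deterministic : ∀ {p Γ} {ρ : Env Γ} {e w w′ c c′} →
                  p , ρ ⊢ e ⇓ w [ c ] → p , ρ ⊢ e ⇓ w′ [ c′ ] → w ≡ w′ × c ≡ c′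
⇓-deterministic var var = refl , refl
⇓-deterministic const const = refl , refl
⇓-deterministic (arith a b) (arith a′ b′)
  with refl , refl ← ⇓-deterministic a a′ | refl , refl ← ⇓-deterministic b b′ = refl , refl
⇓-deterministic (div a b) (div a′ b′)
  with refl , refl ← ⇓-deterministic a a′ | refl , refl ← ⇓-deterministic b b′ = refl , refl
⇓-deterministic (if-≤ a b _ e) (if-≤ a′ b′ _ e′)
  with refl , refl ← ⇓-deterministic a a′ | refl , refl ← ⇓-deterministic b b′
  with refl , refl ← ⇓-deterministic e e′ = refl , refl
⇓-deterministic (if-≤ a b q≤r _) (if-≰ a′ b′ q≰r _)
  with refl , refl ← ⇓-deterministic a a′ | refl , refl ← ⇓-deterministic b b′ = contradiction q≤r q≰r
⇓-deterministic (if-≰ a b q≰r _) (if-≤ a′ b′ q≤r _)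
  with refl , refl ← ⇓-deterministic a a′ | refl , refl ← ⇓-deterministic b b′ = contradiction q≤r q≰r
⇓-deterministic (if-≰ a b _ e) (if-≰ a′ b′ _ e′)
  with refl , refl ← ⇓-deterministic a a′ | refl , refl ← ⇓-deterministic b b′
  with refl , refl ← ⇓-deterministic e e′ = refl , refl
⇓-deterministic nil nil = refl , refl
⇓-deterministic (cons a b) (cons a′ b′)
  with refl , refl ← ⇓-deterministic a a′ | refl , refl ← ⇓-deterministic b b′ = refl , refl
⇓-deterministic (case-nil a b) (case-nil a′ b′)
  with refl , refl ← ⇓-deterministic a a′ | refl , refl ← ⇓-deterministic b b′ = refl , refl
⇓-deterministic (case-nil a _) (case-cons a′ _) with () , _ ← ⇓-deterministic a a′
⇓-deterministic (case-cons a _) (case-nil a′ _) with () , _ ← ⇓-deterministic a a′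
⇓-deterministic (case-cons a b) (case-cons a′ b′)
  with refl , refl ← ⇓-deterministic a a′
  with refl , refl ← ⇓-deterministic b b′ = refl , refl
⇓-deterministic (let′ a b) (let′ a′ b′)
  with refl , refl ← ⇓-deterministic a a′
  with refl , refl ← ⇓-deterministic b b′ = refl , refl
⇓-deterministic (call a b) (call a′ b′)
  with refl , refl ← ⇓-deterministic a a′
  with refl , refl ← ⇓-deterministic b b′ = refl , refl

Procedure : Set
Procedure = Exp 13 1

pattern gtᵖ       = Fin.zero
pattern mergeᵖ    = Fin.suc gtᵖ
pattern absorbᵖ   = Fin.suc mergeᵖ
pattern passᵖ     = Fin.suc absorbᵖ
pattern loopᵖ     = Fin.suc passᵖ
pattern mergeWᵖ   = Fin.suc loopᵖ
pattern startWᵖ   = Fin.suc mergeWᵖ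
pattern passWᵖ    = Fin.suc startWᵖ
pattern loopWᵖ    = Fin.suc passWᵖ
pattern wrapᵖ     = Fin.suc loopWᵖ
pattern singlesᵖ  = Fin.suc wrapᵖ
pattern classifyᵖ = Fin.suc singlesᵖ
pattern indicesᵖ  = Fin.suc classifyᵖ

-- Binds, from index 0 on, the size, the tie-breaking index, the value, _,
-- the index, _, the weight and the input record of an item.
unpack : ∀ {F Γ} → Exp F Γ → Exp F (8 + Γ) → Exp F Γ
unpack e k = case e nil (case (var (# 1)) nil (case (var (# 1)) nil (case (var (# 1)) nil k)))

-- Truth values are `cons nil nil` and `nil`, so that `case` can branch on them. Equal densities are
-- recognized by comparing both ways, as the language offers only ≤.
gtᵇ : Procedure
gtᵇ =
  case (var (# 0)) nil
  (case (var (# 0)) (cons nil nil)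
   (case (var (# 3)) nil
    (unpack (var (# 4))
     (unpack (var (# 13))
      (let′ (div (var (# 10)) (var (# 8)))
       (let′ (div (var (# 3)) (var (# 1)))
        (if var (# 1) ≤ var (# 0)
         then (if var (# 0) ≤ var (# 1)
               then (if var (# 11) ≤ var (# 3) then nil else cons nil nil)
               else nil)
         else cons nil nil)))))))

-- When one list is exhausted, the other is still copied cell by cell. The cost is thus at least the
-- length of the result, which the lower bound on the running time relies on.
mergeᵇ : Procedure
mergeᵇ =
  case (var (# 0)) nil
  (case (var (# 0))
   (case (var (# 1)) nil
    (cons (var (# 0)) (call mergeᵖ (cons nil (var (# 1))))))
   (case (var (# 3))
    (cons (var (# 0)) (call mergeᵖ (cons (var (# 1)) nil)))
    (case (call gtᵖ (cons (var (# 2)) (var (# 0))))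
     (cons (var (# 0)) (call mergeᵖ (cons (var (# 4)) (var (# 1)))))
     (cons (var (# 4)) (call mergeᵖ (cons (var (# 5)) (var (# 7))))))))

-- Composes two effects: what stands before the marker of the second is copied, and what stands
-- behind it is merged with the whole first effect, whose marker becomes that of the composition.
absorbᵇ : Procedure
absorbᵇ =
  case (var (# 0)) nil
  (case (var (# 1)) nil
   (case (var (# 0))
    (call mergeᵖ (cons (var (# 2)) (var (# 1))))
    (cons (var (# 2)) (call absorbᵖ (cons (var (# 4)) (var (# 3)))))))

mergeWᵇ : Procedure
mergeWᵇ =
  case (var (# 0)) nil
  (case (var (# 1)) nil
   (case (var (# 0))
    (case (var (# 1)) nil
     (case (var (# 0)) nil
      (cons (cons (arith add (var (# 0)) (var (# 6))) (var (# 1)))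
            (call mergeWᵖ (cons (var (# 6)) (cons nil (var (# 3))))))))
    (case (var (# 3))
     (cons (var (# 0)) (call mergeWᵖ (cons (var (# 4)) (cons (var (# 1)) nil))))
     (unpack (var (# 2))
      (unpack (var (# 8))
       (if var (# 8) ≤ var (# 0)
        then cons (var (# 18))
               (call mergeWᵖ (cons (arith add (var (# 22)) (var (# 10))) (cons (var (# 19)) (var (# 21)))))
        else cons (cons (arith add (var (# 6)) (var (# 22))) (var (# 7)))
               (call mergeWᵖ (cons (var (# 22)) (cons (var (# 20)) (var (# 17)))))))))))

-- An unpaired last block is combined with the empty block e, so that every
-- pass handles all items: the lower bound on the running time needs this.
passᵇ : ∀ {F} → Fin F → Fin F → (∀ {Γ} → Exp F Γ) → Exp F 1
passᵇ f g e =
  case (var (# 0)) nil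
  (case (var (# 1))
   (cons (call f (cons (var (# 0)) e)) nil)
   (cons (call f (cons (var (# 2)) (var (# 0)))) (call g (var (# 1)))))

loopᵇ : ∀ {F} → Fin F → Fin F → (∀ {Γ} → Exp F Γ) → Exp F 1
loopᵇ g h e =
  case (var (# 0)) e
  (case (var (# 1)) (var (# 0)) (call h (call g (var (# 4)))))

-- Each item becomes the block of an ordinary insertion, as needed for the sort by density; the
-- weight 0 is a placeholder.
wrapᵇ : Procedure
wrapᵇ =
  case (var (# 0)) nil
  (cons (cons nil (cons (cons (const 0ℚ) (var (# 0))) nil)) (call wrapᵖ (var (# 1))))

singlesᵇ : Procedure
singlesᵇ =
  case (var (# 0)) nil
  (case (var (# 0)) (call singlesᵖ (var (# 1)))
   (cons (cons (var (# 2)) nil) (call singlesᵖ (var (# 3)))))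

classifyᵇ : Procedure
classifyᵇ =
  case (var (# 0)) nil
  (unpack (var (# 0))
   (let′ (if var (# 6) ≤ const 0ℚ then cons nil (cons (var (# 8)) nil)
          else (if var (# 2) ≤ var (# 6) then cons nil (cons (var (# 8)) nil)
                else cons (var (# 8)) (cons nil nil)))
    (cons (var (# 0)) (call classifyᵖ (var (# 10))))))

indicesᵇ : Procedure
indicesᵇ =
  case (var (# 0)) nil
  (case (var (# 0)) (call indicesᵖ (var (# 1)))
   (unpack (var (# 2))
    (cons (var (# 4)) (call indicesᵖ (var (# 11))))))

universalᵖ : Program
universalᵖ = record
  { size = 13
  ; body = gtᵇ ∷ mergeᵇ ∷ absorbᵇ ∷ passᵇ absorbᵖ passᵖ (cons nil nil) ∷ loopᵇ passᵖ loopᵖ (cons nil nil) ∷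
           mergeWᵇ ∷ call mergeWᵖ (cons (const 0ℚ) (var (# 0))) ∷ passᵇ startWᵖ passWᵖ nil ∷ loopᵇ passWᵖ loopWᵖ nil ∷
           wrapᵇ ∷ singlesᵇ ∷ classifyᵇ ∷ indicesᵇ ∷ []
  -- From the inside out: sort by density, compute the weights while sorting by size, classify the
  -- items, perform the insertions, extract the indices.
  ; main = call indicesᵖ (call loopᵖ (call classifyᵖ (call loopWᵖ (call singlesᵖ
             (call loopᵖ (call wrapᵖ (var (# 0))))))))
  }

infix 3 _⟨_⟩⇓_[_,_]
-- The bounds concern the body of the procedure; evaluating the argument and the call itself are
-- charged to the caller.
_⟨_⟩⇓_[_,_] : Fin 13 → Value → Value → ℕ → ℕ → Set
f ⟨ u ⟩⇓ w [ lo , hi ] =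
  ∃[ c ] (universalᵖ , (u ∷ []) ⊢ Vec.lookup (body universalᵖ) f ⇓ w [ c ]) × lo ≤ c × c ≤ hi

-- The program compares tie-breaking indices as rationals; this lemma and the next translate such
-- comparisons from and to ℕ.
fromℕ-mono-≤ : ∀ {m n} → m ≤ n → fromℕ m ℚ.≤ fromℕ n
fromℕ-mono-≤ {m} {n} m≤n = ℚ.*≤*
  (subst₂ ℤ._≤_ (sym (ℤ.*-identityʳ (ℤ.+ m))) (sym (ℤ.*-identityʳ (ℤ.+ n))) (ℤ.+≤+ m≤n))

fromℕ-cancel-≤ : ∀ {m n} → fromℕ m ℚ.≤ fromℕ n → m ≤ n
fromℕ-cancel-≤ {m} {n} h = ℤ.drop‿+≤+
  (subst₂ ℤ._≤_ (ℤ.*-identityʳ (ℤ.+ m)) (ℤ.*-identityʳ (ℤ.+ n)) (ℚ.drop-*≤* h))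

-- Opaque, so that the arguments of a budget can be inferred.
opaque
  budget : ℕ → ℕ
  budget m = 100 * m

  budget≡ : ∀ m → budget m ≡ 100 * m
  budget≡ _ = refl

budget-suc : ∀ m → budget (suc m) ≡ 100 + budget m
budget-suc m rewrite budget≡ (suc m) | budget≡ m = *-suc 100 m

budget-suc-≥ : ∀ {a m} → a ≤ 100 → a ≤ budget (suc m)
budget-suc-≥ {m = m} a≤100 rewrite budget-suc m = ≤-trans a≤100 (m≤m+n 100 _)

-- A step of cost a + b with a subroutine of cost c₁ is paid for by an
-- increment of the budget.
pay : ∀ a b {k m c c₁} → c₁ ≤ k → c ≤ budget m → a + (k + b) ≤ 100 → a + (c₁ + (b + c)) ≤ budget (suc m)
pay a b {k} {m} {c} {c₁} p q r = begin
  a + (c₁ + (b + c)) ≤⟨ +-monoʳ-≤ a (+-monoˡ-≤ (b + c) p) ⟩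
  a + (k + (b + c))  ≡⟨ cong (a +_) (+-assoc k b c) ⟨
  a + ((k + b) + c)  ≡⟨ +-assoc a (k + b) c ⟨
  (a + (k + b)) + c  ≤⟨ ℕ.+-mono-≤ r q ⟩
  100 + budget m     ≡⟨ budget-suc m ⟨
  budget (suc m)     ∎
  where open ℕ.≤-Reasoning

pay₀ : ∀ a {m c} → c ≤ budget m → a ≤ 100 → a + c ≤ budget (suc m)
pay₀ a q r = pay a 0 z≤n q (subst (_≤ _) (sym (ℕ.+-identityʳ a)) r)

budget-+-suc : ∀ m {n c} → c ≤ budget (suc (suc (m + n))) → c ≤ budget (suc (m + suc n))
budget-+-suc m {n} {c} = subst (λ k → c ≤ budget (suc k)) (sym (+-suc m n))

bool : Bool → Value
bool true  = cons nil nil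
bool false = nil

-- Specifications and costs of the procedures.

module Procedures {n : ℕ} (I : Instance n) where
  open Instance I

  infix 5 _≻ᵇ_

  -- The marker, nothing, precedes every item; it is encoded as nil.
  _≻ᵇ_ : Maybe (Fin n) → Maybe (Fin n) → Bool
  nothing ≻ᵇ _       = true
  just p  ≻ᵇ nothing = false
  just p  ≻ᵇ just b  = does (p ≻? b)

  item : Fin n → Value
  item i = cons (index i) (cons (num (v i)) (cons (num (l i)) (num (fromℕ (t i)))))

  weighted : ℚ → Fin n → Value
  weighted w i = cons (num w) (item i)

  marked : (Fin n → ℚ) → Maybe (Fin n) → Value
  marked ω nothing  = nil
  marked ω (just i) = weighted (ω i) i

  marks : (Fin n → ℚ) → List (Maybe (Fin n)) → Value
  marks ω X = list (map (marked ω) X)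

  gt-run : ∀ ω p b → gtᵖ ⟨ cons (marked ω p) (marked ω b) ⟩⇓ bool (p ≻ᵇ b) [ 0 , 60 ]
  gt-run ω nothing b = _ , case-cons var (case-nil var (cons nil nil)) , z≤n , ≤ᵇ⇒≤ _ _ tt
  gt-run ω (just p) nothing = _ , case-cons var (case-cons var (case-nil var nil)) , z≤n , ≤ᵇ⇒≤ _ _ tt
  gt-run ω (just p) (just b) = decide
    where
    instance
      _ = ℚ.pos⇒nonZero (l p) {{l>0 p}}
      _ = ℚ.pos⇒nonZero (l b) {{l>0 b}}

    -- Unpacking both items and dividing twice is common to all outcomes: eleven `case` at 2 units
    -- each and two `let′` at 4 give 30.
    compare : ∀ {c w} →
      universalᵖ , num (d b) ∷ num (d p) ∷
        num (l b) ∷ num (fromℕ (t b)) ∷ num (v b) ∷ cons (num (l b)) (num (fromℕ (t b))) ∷ index b ∷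
        cons (num (v b)) (cons (num (l b)) (num (fromℕ (t b)))) ∷ num (ω b) ∷ item b ∷
        num (l p) ∷ num (fromℕ (t p)) ∷ num (v p) ∷ cons (num (l p)) (num (fromℕ (t p))) ∷ index p ∷
        cons (num (v p)) (cons (num (l p)) (num (fromℕ (t p)))) ∷ num (ω p) ∷ item p ∷
        num (ω b) ∷ item b ∷ num (ω p) ∷ item p ∷ marked ω (just p) ∷ marked ω (just b) ∷
        cons (marked ω (just p)) (marked ω (just b)) ∷ []
        ⊢ (if var (# 1) ≤ var (# 0)
           then (if var (# 0) ≤ var (# 1)
                 then (if var (# 11) ≤ var (# 3) then nil else cons nil nil)
                 else nil)
           else cons nil nil) ⇓ w [ c ] →
      universalᵖ , (cons (marked ω (just p)) (marked ω (just b)) ∷ []) ⊢ gtᵇ ⇓ w [ 30 + c ]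
    compare e = case-cons var (case-cons var (case-cons var
      (case-cons var (case-cons var (case-cons var (case-cons var
      (case-cons var (case-cons var (case-cons var (case-cons var
      (let′ (div var var) (let′ (div var var) e))))))))))))

    decide : gtᵖ ⟨ cons (marked ω (just p)) (marked ω (just b)) ⟩⇓ bool (does (p ≻? b)) [ 0 , 60 ]
    decide with d p ℚ.≤? d b
    ... | no ≰ rewrite dec-true (p ≻? b) (inj₁ (ℚ.≰⇒> ≰)) =
      _ , compare (if-≰ var var ≰ (cons nil nil)) , z≤n , ≤ᵇ⇒≤ _ _ tt
    ... | yes ≤₁ with d b ℚ.≤? d p
    ...   | no ≰ rewrite dec-false (p ≻? b) [ (λ db<dp → ℚ.<-irrefl refl (ℚ.<-≤-trans db<dp ≤₁)) , (λ (eq , _) → ≰ (ℚ.≤-reflexive (sym eq))) ]′ =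
      _ , compare (if-≤ var var ≤₁ (if-≰ var var ≰ nil)) , z≤n , ≤ᵇ⇒≤ _ _ tt
    ...   | yes ≤₂ with fromℕ (t p) ℚ.≤? fromℕ (t b)
    ...     | yes ≤₃ rewrite dec-false (p ≻? b) [ (λ db<dp → ℚ.<-irrefl refl (ℚ.<-≤-trans db<dp ≤₁)) , (λ (_ , tb<tp) → ℕ.<⇒≱ tb<tp (fromℕ-cancel-≤ ≤₃)) ]′ =
      _ , compare (if-≤ var var ≤₁ (if-≤ var var ≤₂ (if-≤ var var ≤₃ nil))) , z≤n , ≤ᵇ⇒≤ _ _ tt
    ...     | no ≰ rewrite dec-true (p ≻? b) (inj₂ (ℚ.≤-antisym ≤₁ ≤₂ , ℕ.≰⇒> (λ h → ≰ (fromℕ-mono-≤ h)))) =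
      _ , compare (if-≤ var var ≤₁ (if-≤ var var ≤₂ (if-≰ var var ≰ (cons nil nil)))) , z≤n , ≤ᵇ⇒≤ _ _ tt

  merge : List (Maybe (Fin n)) → List (Maybe (Fin n)) → List (Maybe (Fin n))
  merge []      B       = B
  merge (p ∷ X) []      = p ∷ merge X []
  merge (p ∷ X) (b ∷ B) =
    ifᵇ p ≻ᵇ b then p ∷ merge X (b ∷ B) else b ∷ merge (p ∷ X) B

  -- A step with a comparison costs at most 11 + 60 + 6 units, within the 100 that one more list
  -- entry pays for.
  merge-run : ∀ ω X B → mergeᵖ ⟨ cons (marks ω X) (marks ω B) ⟩⇓ marks ω (merge X B)
              [ length (merge X B) , budget (suc (length X + length B)) ]
  merge-run ω [] [] = _ , case-cons var (case-nil var (case-nil var nil)) , z≤n , budget-suc-≥ (≤ᵇ⇒≤ _ _ tt)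
  merge-run ω [] (b ∷ B) =
    let _ , r , lo , hi = merge-run ω [] B in
    _ , case-cons var (case-nil var (case-cons var (cons var (call (cons nil var) r)))) ,
    s≤s (≤-trans lo (m≤n+m _ 11)) , pay₀ 12 hi (≤ᵇ⇒≤ _ _ tt)
  merge-run ω (p ∷ X) [] =
    let _ , r , lo , hi = merge-run ω X [] in
    _ , case-cons var (case-cons var (case-nil var (cons var (call (cons var nil) r)))) ,
    s≤s (≤-trans lo (m≤n+m _ 11)) , pay₀ 12 hi (≤ᵇ⇒≤ _ _ tt)
  merge-run ω (p ∷ X) (b ∷ B) with p ≻ᵇ b | gt-run ω p b | merge-run ω X (b ∷ B) | merge-run ω (p ∷ X) B
  ... | true  | c , g , _ , g≤60 | _ , r , lo , hi | _ =
    _ , case-cons var (case-cons var (case-cons var (case-cons (call (cons var var) g)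
          (cons var (call (cons var var) r))))) ,
    s≤s (≤-trans lo (≤-trans (m≤n+m _ 6) (m≤n+m _ (10 + c)))) , pay 11 6 g≤60 hi (≤ᵇ⇒≤ _ _ tt)
  ... | false | c , g , _ , g≤60 | _ | _ , r , lo , hi =
    _ , case-cons var (case-cons var (case-cons var (case-nil (call (cons var var) g)
          (cons var (call (cons var var) r))))) ,
    s≤s (≤-trans lo (≤-trans (m≤n+m _ 6) (m≤n+m _ (10 + c)))) ,
    budget-+-suc (suc (length X)) (pay 11 6 g≤60 hi (≤ᵇ⇒≤ _ _ tt))

  -- The first clause is a default, since every effect contains the marker; the value `[]` keeps
  -- `insert-absorb` true for all lists.
  absorb : List (Maybe (Fin n)) → List (Maybe (Fin n)) → List (Maybe (Fin n))
  absorb X []            = []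
  absorb X (nothing ∷ B) = merge X B
  absorb X (just x ∷ Y)  = just x ∷ absorb X Y

  absorb-run : ∀ ω X Y → absorbᵖ ⟨ cons (marks ω X) (marks ω Y) ⟩⇓ marks ω (absorb X Y)
               [ length (absorb X Y) , budget (suc (length X + length Y)) ]
  absorb-run ω X [] = _ , case-cons var (case-nil var nil) , z≤n , budget-suc-≥ (≤ᵇ⇒≤ _ _ tt)
  absorb-run ω X (nothing ∷ B) =
    let _ , r , lo , hi = merge-run ω X B in
    _ , case-cons var (case-cons var (case-nil var (call (cons var var) r))) ,
    ≤-trans lo (m≤n+m _ 10) ,
    budget-+-suc (length X) (pay₀ 10 hi (≤ᵇ⇒≤ _ _ tt))
  absorb-run ω X (just x ∷ Y) =
    let _ , r , lo , hi = absorb-run ω X Y in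
    _ , case-cons var (case-cons var (case-cons var (cons var (call (cons var var) r)))) ,
    s≤s (≤-trans lo (m≤n+m _ 11)) ,
    budget-+-suc (length X) (pay₀ 12 hi (≤ᵇ⇒≤ _ _ tt))

  weights : List (Fin n × ℚ) → Value
  weights xs = list (map (λ (i , w) → weighted w i) xs)

  -- Ties in size go to the left list: its items are the denser ones and must count towards a right
  -- item of the same size.
  mergeW : ℚ → List (Fin n × ℚ) → List (Fin n × ℚ) → List (Fin n × ℚ)
  mergeW a []             []             = []
  mergeW a []             ((y , w) ∷ ys) = (y , w ℚ.+ a) ∷ mergeW a [] ys
  mergeW a (x ∷ xs)       []             = x ∷ mergeW a xs []
  mergeW a ((x , u) ∷ xs) ((y , w) ∷ ys) =
    ifᵇ does (l x ℚ.≤? l y)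
    then (x , u) ∷ mergeW (a ℚ.+ v x) xs ((y , w) ∷ ys)
    else (y , w ℚ.+ a) ∷ mergeW a ((x , u) ∷ xs) ys

  mergeW-run : ∀ a xs ys → mergeWᵖ ⟨ cons (num a) (cons (weights xs) (weights ys)) ⟩⇓ weights (mergeW a xs ys)
               [ length (mergeW a xs ys) , budget (suc (length xs + length ys)) ]
  mergeW-run a [] [] =
    _ , case-cons var (case-cons var (case-nil var (case-nil var nil))) , z≤n , budget-suc-≥ (≤ᵇ⇒≤ _ _ tt)
  mergeW-run a [] ((y , w) ∷ ys) =
    let _ , r , lo , hi = mergeW-run a [] ys in
    _ , case-cons var (case-cons var (case-nil var (case-cons var (case-cons var
          (cons (cons (arith var var) var) (call (cons var (cons nil var)) r)))))) ,
    s≤s (≤-trans lo (m≤n+m _ _)) , pay₀ 22 hi (≤ᵇ⇒≤ _ _ tt)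
  mergeW-run a ((x , u) ∷ xs) [] =
    let _ , r , lo , hi = mergeW-run a xs [] in
    _ , case-cons var (case-cons var (case-cons var (case-nil var
          (cons var (call (cons var (cons var nil)) r))))) ,
    s≤s (≤-trans lo (m≤n+m _ 15)) , pay₀ 16 hi (≤ᵇ⇒≤ _ _ tt)
  mergeW-run a ((x , u) ∷ xs) ((y , w) ∷ ys)
    with l x ℚ.≤? l y | mergeW-run (a ℚ.+ v x) xs ((y , w) ∷ ys) | mergeW-run a ((x , u) ∷ xs) ys
  ... | yes x≤y | _ , r , lo , hi | _ rewrite dec-true (l x ℚ.≤? l y) x≤y =
    _ , case-cons var (case-cons var (case-cons var (case-cons var
          (case-cons var (case-cons var (case-cons var (case-cons var
          (case-cons var (case-cons var (case-cons var (case-cons var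
          (if-≤ var var x≤y
            (cons var (call (cons (arith var var) (cons var var)) r))))))))))))) ) ,
    s≤s (≤-trans lo (m≤n+m _ 36)) , pay₀ 37 hi (≤ᵇ⇒≤ _ _ tt)
  ... | no x≰y | _ | _ , r , lo , hi rewrite dec-false (l x ℚ.≤? l y) x≰y =
    _ , case-cons var (case-cons var (case-cons var (case-cons var
          (case-cons var (case-cons var (case-cons var (case-cons var
          (case-cons var (case-cons var (case-cons var (case-cons var
          (if-≰ var var x≰y
            (cons (cons (arith var var) var) (call (cons var (cons var var)) r))))))))))))) ) ,
    s≤s (≤-trans lo (m≤n+m _ 38)) ,
    budget-+-suc (suc (length xs)) (pay₀ 39 hi (≤ᵇ⇒≤ _ _ tt))

  startW-run : ∀ xs ys → startWᵖ ⟨ cons (weights xs) (weights ys) ⟩⇓ weights (mergeW 0ℚ xs ys)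
               [ length (mergeW 0ℚ xs ys) , 10 + budget (suc (length xs + length ys)) ]
  startW-run xs ys =
    let _ , r , lo , hi = mergeW-run 0ℚ xs ys in
    _ , call (cons const var) r , ≤-trans lo (m≤n+m _ 4) , ℕ.+-mono-≤ {4} {10} (≤ᵇ⇒≤ _ _ tt) hi

  wrap-run : ∀ (xs : List (Fin n)) →
             wrapᵖ ⟨ list (map item xs) ⟩⇓ list (map (λ i → marks (λ _ → 0ℚ) (nothing ∷ just i ∷ [])) xs)
             [ 0 , budget (suc (length xs)) ]
  wrap-run [] = _ , case-nil var nil , z≤n , budget-suc-≥ (≤ᵇ⇒≤ _ _ tt)
  wrap-run (x ∷ xs) =
    let _ , r , _ , hi = wrap-run xs in
    _ , case-cons var (cons (cons nil (cons (cons const var) nil)) (call var r)) , z≤n ,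
    pay₀ 12 hi (≤ᵇ⇒≤ _ _ tt)

  singles-run : ∀ X → singlesᵖ ⟨ marks (λ _ → 0ℚ) X ⟩⇓ list (map (λ i → weights ((i , 0ℚ) ∷ [])) (catMaybes X))
                [ 0 , budget (suc (length X)) ]
  singles-run [] = _ , case-nil var nil , z≤n , budget-suc-≥ (≤ᵇ⇒≤ _ _ tt)
  singles-run (nothing ∷ X) =
    let _ , r , _ , hi = singles-run X in
    _ , case-cons var (case-nil var (call var r)) , z≤n , pay₀ 6 hi (≤ᵇ⇒≤ _ _ tt)
  singles-run (just x ∷ X) =
    let _ , r , _ , hi = singles-run X in
    _ , case-cons var (case-cons var (cons (cons var nil) (call var r))) , z≤n , pay₀ 10 hi (≤ᵇ⇒≤ _ _ tt)

  isSwapWeight : Fin n → ℚ → Bool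
  isSwapWeight i w = does (0ℚ ℚ.<? w) ∧ does (w ℚ.<? v i)

  -- The effect of a single insertion on the marker: a swap item goes in front of it, any other item
  -- behind it.
  leaf : Bool → Fin n → List (Maybe (Fin n))
  leaf true  i = just i ∷ nothing ∷ []
  leaf false i = nothing ∷ just i ∷ []

  classify-run : ∀ ω xs → classifyᵖ ⟨ weights (map (λ i → i , ω i) xs) ⟩⇓
                 list (map (λ i → marks ω (leaf (isSwapWeight i (ω i)) i)) xs)
                 [ 0 , budget (suc (length xs)) ]
  classify-run ω [] = _ , case-nil var nil , z≤n , budget-suc-≥ (≤ᵇ⇒≤ _ _ tt)
  classify-run ω (x ∷ xs) with ω x ℚ.≤? 0ℚ | v x ℚ.≤? ω x | classify-run ω xs
  ... | yes w≤0 | _ | _ , r , _ , hi rewrite dec-false (0ℚ ℚ.<? ω x) (λ 0<w → ℚ.<-irrefl refl (ℚ.<-≤-trans 0<w w≤0)) =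
    _ , case-cons var (case-cons var (case-cons var (case-cons var (case-cons var
          (let′ (if-≤ var const w≤0 (cons nil (cons var nil))) (cons var (call var r))))))) ,
    z≤n , pay₀ 23 hi (≤ᵇ⇒≤ _ _ tt)
  ... | no w≰0 | yes v≤w | _ , r , _ , hi
    rewrite dec-true (0ℚ ℚ.<? ω x) (ℚ.≰⇒> w≰0) | dec-false (ω x ℚ.<? v x) (λ w<v → ℚ.<-irrefl refl (ℚ.<-≤-trans w<v v≤w)) =
    _ , case-cons var (case-cons var (case-cons var (case-cons var (case-cons var
          (let′ (if-≰ var const w≰0 (if-≤ var var v≤w (cons nil (cons var nil)))) (cons var (call var r))))))) ,
    z≤n , pay₀ 26 hi (≤ᵇ⇒≤ _ _ tt)
  ... | no w≰0 | no v≰w | _ , r , _ , hi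
    rewrite dec-true (0ℚ ℚ.<? ω x) (ℚ.≰⇒> w≰0) | dec-true (ω x ℚ.<? v x) (ℚ.≰⇒> v≰w) =
    _ , case-cons var (case-cons var (case-cons var (case-cons var (case-cons var
          (let′ (if-≰ var const w≰0 (if-≰ var var v≰w (cons var (cons nil nil)))) (cons var (call var r))))))) ,
    z≤n , pay₀ 26 hi (≤ᵇ⇒≤ _ _ tt)

  indices-run : ∀ ω X → indicesᵖ ⟨ marks ω X ⟩⇓ encodePolicy (catMaybes X) [ 0 , budget (suc (length X)) ]
  indices-run ω [] = _ , case-nil var nil , z≤n , budget-suc-≥ (≤ᵇ⇒≤ _ _ tt)
  indices-run ω (nothing ∷ X) =
    let _ , r , _ , hi = indices-run ω X in
    _ , case-cons var (case-nil var (call var r)) , z≤n , pay₀ 6 hi (≤ᵇ⇒≤ _ _ tt)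
  indices-run ω (just x ∷ X) =
    let _ , r , _ , hi = indices-run ω X in
    _ , case-cons var (case-cons var
          (case-cons var (case-cons var (case-cons var (case-cons var (cons var (call var r))))))) ,
    z≤n , pay₀ 16 hi (≤ᵇ⇒≤ _ _ tt)

-- Divide and conquer

pairUp : ∀ {A : Set} → List (List A) → List (List A)
pairUp []             = []
pairUp (R ∷ [])       = (R ++ []) ∷ []
pairUp (R ∷ S ∷ Ss)   = (R ++ S) ∷ pairUp Ss

concat-pairUp : ∀ {A : Set} (Ss : List (List A)) → concat (pairUp Ss) ≡ concat Ss
concat-pairUp []           = refl
concat-pairUp (R ∷ [])     = ++-identityʳ (R ++ [])
concat-pairUp (R ∷ S ∷ Ss) = trans (++-assoc R S _) (cong (λ T → R ++ S ++ T) (concat-pairUp Ss))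

length-pairUp : ∀ {A : Set} (Ss : List (List A)) → length (pairUp Ss) ≡ ⌈ length Ss /2⌉
length-pairUp []           = refl
length-pairUp (R ∷ [])     = refl
length-pairUp (R ∷ S ∷ Ss) = cong suc (length-pairUp Ss)

⌈log₂⌉-suc : ∀ k → ⌈log₂ 2 + k ⌉ ≡ suc ⌈log₂ ⌈ 2 + k /2⌉ ⌉
⌈log₂⌉-suc k =
  trans (sym (ℕ.m+[n∸m]≡n (⌈log₂⌉-mono-≤ {2} {2 + k} (s≤s (s≤s z≤n)))))
        (cong suc (sym (⌈log₂⌈n/2⌉⌉≡⌈log₂n⌉∸1 (2 + k))))

-- Applied to the effects of insertions and to the weighted merge sort alike. `Block S x` says that
-- `x` represents the segment `S`; `f` joins adjacent segments, `g` is a pass, `h` iterates passes,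
-- and `e` is the empty block. The constant `K` also has to cover the fixed overhead of a step,
-- including an evaluation of `e`. The lower bound in `f-run` charges one unit per item.
module DivideAndConquer
  {A : Set} (Block : List A → Value → Set)
  (f g h : Fin 13) (e : ∀ {Γ} → Exp 13 Γ)
  (pass-body : Vec.lookup (body universalᵖ) g ≡ passᵇ f g e)
  (loop-body : Vec.lookup (body universalᵖ) h ≡ loopᵇ g h e)
  {z₀ : Value} {c₀ : ℕ}
  (e-run : ∀ {Γ} {ρ : Env Γ} → universalᵖ , ρ ⊢ e ⇓ z₀ [ c₀ ])
  (empty : Block [] z₀)
  (K : ℕ) (20+c₀≤K : 20 + c₀ ≤ K)
  (f-run : ∀ {R S x y} → Block R x → Block S y →
           ∃[ z ] Block (R ++ S) z × f ⟨ cons x y ⟩⇓ z [ length R + length S , K * suc (length R + length S) ])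
  where

  a≤K : ∀ {a} → a ≤ 20 → a ≤ K
  a≤K a≤20 = ≤-trans (≤-trans a≤20 (m≤m+n 20 c₀)) 20+c₀≤K

  weight : List (List A) → ℕ
  weight Ss = length (concat Ss)

  -- The `s` items pay for the linear part of the calls of `f`; the `k` blocks pay for the constant
  -- part of each call and for the overhead of the pass.
  passBudget : ℕ → ℕ → ℕ
  passBudget s k = 2 * K * suc (s + k)

  pass-run : ∀ {Ss xs} → Pointwise Block Ss xs →
             ∃[ ys ] Pointwise Block (pairUp Ss) ys ×
             g ⟨ list xs ⟩⇓ list ys [ weight Ss , passBudget (weight Ss) (length Ss) ]
  pass-run [] rewrite pass-body =
    _ , [] , _ , case-nil var nil , z≤n , hi≤
    where
    hi≤ : 3 ≤ passBudget 0 0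
    hi≤ = begin
      3             ≤⟨ a≤K (≤ᵇ⇒≤ _ _ tt) ⟩
      K             ≤⟨ m≤m+n K K ⟩
      K + K         ≡⟨ identity K ⟩
      2 * K * 1     ∎
      where
      open ℕ.≤-Reasoning
      identity : ∀ K → K + K ≡ 2 * K * 1
      identity = solve-∀
  pass-run {R ∷ []} {x ∷ []} (b ∷ []) rewrite pass-body
    with z , b′ , c , r , lo , hi ← f-run b empty =
    _ , b′ ∷ [] , _ , case-cons var (case-nil var (cons (call (cons var e-run) r) nil)) ,
    lo≤ , hi≤
    where
    cost = 5 + (3 + c₀ + c + 1)
    open ℕ.≤-Reasoning

    lo≤ : weight (R ∷ []) ≤ cost
    lo≤ = begin
      length (R ++ [])      ≡⟨ length-++ R ⟩
      length R + 0          ≤⟨ lo ⟩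
      c                     ≤⟨ m≤n+m c (3 + c₀) ⟩
      3 + c₀ + c            ≤⟨ m≤m+n _ 1 ⟩
      3 + c₀ + c + 1        ≤⟨ m≤n+m _ 5 ⟩
      cost                  ∎

    hi≤ : cost ≤ passBudget (weight (R ∷ [])) 1
    hi≤ = begin
      5 + (3 + c₀ + c + 1)                     ≡⟨ identity₁ c₀ c ⟩
      (9 + c₀) + c                             ≤⟨ ℕ.+-mono-≤ (≤-trans (+-monoˡ-≤ c₀ (≤ᵇ⇒≤ _ _ tt)) 20+c₀≤K) hi ⟩
      K + K * suc (length R + 0)               ≤⟨ m≤m+n _ (2 * K + K * (length R + 0)) ⟩
      K + K * suc (length R + 0) + (2 * K + K * (length R + 0)) ≡⟨ identity₂ K (length R + 0) ⟩
      2 * K * suc (length R + 0 + 1)           ≡⟨ cong (λ s → 2 * K * suc (s + 1)) (length-++ R) ⟨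
      passBudget (weight (R ∷ [])) 1           ∎
      where
      identity₁ : ∀ c₀ c → 5 + (3 + c₀ + c + 1) ≡ (9 + c₀) + c
      identity₁ = solve-∀
      identity₂ : ∀ K s → K + K * (1 + s) + (2 * K + K * s) ≡ 2 * K * (1 + (s + 1))
      identity₂ = solve-∀
  pass-run {R ∷ S ∷ Ss} {x ∷ y ∷ xs} (b ∷ b₁ ∷ bs)
    with z , b′ , c , r , lo , hi ← f-run b b₁ | zs , bs′ , c′ , r′ , lo′ , hi′ ← pass-run bs =
    _ , b′ ∷ bs′ , cost ,
    subst (λ e → universalᵖ , _ ⊢ e ⇓ _ [ _ ]) (sym pass-body)
      (case-cons var (case-cons var (cons (call (cons var var) r) (call var r′)))) ,
    lo≤ , hi≤
    where
    cost = 5 + (4 + c + (2 + c′))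
    s = length R + length S
    s′ = weight Ss
    k = length Ss
    open ℕ.≤-Reasoning

    weight≡ : weight (R ∷ S ∷ Ss) ≡ s + s′
    weight≡ = trans (length-++ R) (trans (cong (length R +_) (length-++ S)) (sym (+-assoc (length R) _ _)))

    lo≤ : weight (R ∷ S ∷ Ss) ≤ cost
    lo≤ = begin
      weight (R ∷ S ∷ Ss)    ≡⟨ weight≡ ⟩
      s + s′                 ≤⟨ ℕ.+-mono-≤ (≤-trans lo (m≤n+m c 4)) (≤-trans lo′ (m≤n+m c′ 2)) ⟩
      4 + c + (2 + c′)       ≤⟨ m≤n+m _ 5 ⟩
      cost                   ∎

    hi≤ : cost ≤ passBudget (weight (R ∷ S ∷ Ss)) (2 + k)
    hi≤ = begin
      5 + (4 + c + (2 + c′))                     ≡⟨ identity₁ c c′ ⟩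
      11 + (c + c′)                              ≤⟨ ℕ.+-mono-≤ (a≤K (≤ᵇ⇒≤ 11 20 tt)) (ℕ.+-mono-≤ hi hi′) ⟩
      K + (K * suc s + 2 * K * suc (s′ + k))     ≤⟨ m≤m+n _ (2 * K + K * s) ⟩
      K + (K * suc s + 2 * K * suc (s′ + k)) + (2 * K + K * s) ≡⟨ identity₂ K s s′ k ⟩
      2 * K * suc (s + s′ + (2 + k))             ≡⟨ cong (λ s → 2 * K * suc (s + (2 + k))) weight≡ ⟨
      passBudget (weight (R ∷ S ∷ Ss)) (2 + k)   ∎
      where
      identity₁ : ∀ c c′ → 5 + (4 + c + (2 + c′)) ≡ 11 + (c + c′)
      identity₁ = solve-∀
      identity₂ : ∀ K s s′ k → K + (K * (1 + s) + 2 * K * (1 + (s′ + k))) + (2 * K + K * s) ≡ 2 * K * (1 + (s + s′ + (2 + k)))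
      identity₂ = solve-∀

  -- A pass preserves the concatenation and halves the number of blocks, rounding up. Hence ⌈log₂ k⌉
  -- passes take place for k blocks, each costing at least one unit per item. The recursion is on
  -- the number of blocks, as `pairUp` does not return a sublist.
  loop-run : ∀ {Ss xs} → Pointwise Block Ss xs → Acc _<_ (length Ss) →
             ∃[ z ] Block (concat Ss) z ×
             h ⟨ list xs ⟩⇓ z [ weight Ss * ⌈log₂ length Ss ⌉ , suc ⌈log₂ length Ss ⌉ * (K + passBudget (weight Ss) (length Ss)) ]
  loop-run [] _ rewrite loop-body =
    _ , empty , _ , case-nil var e-run , z≤n ,
    ≤-trans (≤-trans (+-monoˡ-≤ c₀ (≤ᵇ⇒≤ 2 20 tt)) 20+c₀≤K) (≤-trans (m≤m+n K _) (m≤m+n _ 0))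
  loop-run {R ∷ []} (b ∷ []) _ rewrite loop-body =
    _ , subst (λ S → Block S _) (sym (++-identityʳ R)) b , _ , case-cons var (case-nil var var) ,
    subst (_≤ 5) (sym (ℕ.*-zeroʳ (length (R ++ [])))) z≤n ,
    ≤-trans (a≤K (≤ᵇ⇒≤ 5 20 tt)) (≤-trans (m≤m+n K _) (m≤m+n _ 0))
  loop-run {R ∷ S ∷ Ss} {x ∷ y ∷ xs} bs@(b ∷ b₁ ∷ _) (acc smaller)
    with ys , bs′ , c , r , lo , hi ← pass-run bs
    with z , b′ , c′ , r′ , lo′ , hi′ ←
      loop-run bs′ (smaller (subst (_< 2 + length Ss) (sym (length-pairUp (R ∷ S ∷ Ss))) (ℕ.⌈n/2⌉<n (length Ss)))) =
    z , subst (λ T → Block T z) (concat-pairUp (R ∷ S ∷ Ss)) b′ , cost ,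
    subst (λ e → universalᵖ , _ ⊢ e ⇓ _ [ _ ]) (sym loop-body)
      (case-cons var (case-cons var (call (call var r) r′))) ,
    lo≤ , hi≤
    where
    cost = 5 + (2 + c + c′)
    w = weight (R ∷ S ∷ Ss)
    k = length (R ∷ S ∷ Ss)
    k′ = length (pairUp (R ∷ S ∷ Ss))
    open ℕ.≤-Reasoning

    weight′≡ : weight (pairUp (R ∷ S ∷ Ss)) ≡ w
    weight′≡ = cong length (concat-pairUp (R ∷ S ∷ Ss))

    log≡ : suc ⌈log₂ k′ ⌉ ≡ ⌈log₂ k ⌉
    log≡ = trans (cong (λ j → suc ⌈log₂ j ⌉) (length-pairUp (R ∷ S ∷ Ss))) (sym (⌈log₂⌉-suc (length Ss)))

    k′≤k : k′ ≤ k
    k′≤k = subst (_≤ k) (sym (length-pairUp (R ∷ S ∷ Ss))) (ℕ.⌈n/2⌉≤n k)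

    lo≤ : w * ⌈log₂ k ⌉ ≤ cost
    lo≤ = begin
      w * ⌈log₂ k ⌉           ≡⟨ cong (w *_) log≡ ⟨
      w * suc ⌈log₂ k′ ⌉      ≡⟨ *-suc w _ ⟩
      w + w * ⌈log₂ k′ ⌉      ≤⟨ ℕ.+-mono-≤ (≤-trans lo (m≤n+m c 2)) (subst (λ w → w * ⌈log₂ k′ ⌉ ≤ c′) weight′≡ lo′) ⟩
      2 + c + c′              ≤⟨ m≤n+m _ 5 ⟩
      cost                    ∎

    hi≤ : cost ≤ suc ⌈log₂ k ⌉ * (K + passBudget w k)
    hi≤ = begin
      5 + (2 + c + c′)        ≡⟨⟩
      7 + c + c′              ≤⟨ ℕ.+-mono-≤ (ℕ.+-mono-≤ (a≤K (≤ᵇ⇒≤ 7 20 tt)) hi) hi′ ⟩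
      K + passBudget w k + suc ⌈log₂ k′ ⌉ * (K + passBudget (weight (pairUp (R ∷ S ∷ Ss))) k′)
        ≤⟨ +-monoʳ-≤ (K + passBudget w k) (ℕ.*-mono-≤ (≤-reflexive log≡)
             (+-monoʳ-≤ K (ℕ.*-monoʳ-≤ (2 * K) (s≤s (ℕ.+-mono-≤ (≤-reflexive weight′≡) k′≤k))))) ⟩
      K + passBudget w k + ⌈log₂ k ⌉ * (K + passBudget w k) ∎

-- Blocks

Pointwise-singletons : ∀ {A : Set} {Block : List A → Value → Set} {enc : A → Value} →
                       (∀ x → Block [ x ] (enc x)) → ∀ xs → Pointwise Block (map [_] xs) (map enc xs)
Pointwise-singletons block []       = []
Pointwise-singletons block (x ∷ xs) = block x ∷ Pointwise-singletons block xs

does-elim : ∀ {A : Set} (a? : Dec A) → does a? ≡ true → A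
does-elim (yes a) _ = a

-- The two inner summands 1 are the markers of the two effects.
absorb-budget : ∀ r s → budget (suc (r + 1 + (s + 1))) ≤ 400 * suc (r + s)
absorb-budget r s = begin
  budget (suc (r + 1 + (s + 1)))         ≡⟨ budget≡ _ ⟩
  100 * suc (r + 1 + (s + 1))            ≤⟨ ℕ.*-monoʳ-≤ 100 (m≤m+n (suc (r + 1 + (s + 1))) (suc (3 * (r + s)))) ⟩
  100 * (suc (r + 1 + (s + 1)) + suc (3 * (r + s)))   ≡⟨ cong (100 *_) (identity r s) ⟩
  100 * (4 * suc (r + s))                ≡⟨ ℕ.*-assoc 100 4 (suc (r + s)) ⟨
  400 * suc (r + s)                      ∎
  where
  open ℕ.≤-Reasoning
  identity : ∀ r s → 1 + (r + 1 + (s + 1)) + (1 + 3 * (r + s)) ≡ 4 * (1 + (r + s))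
  identity = solve-∀

-- The summand 10 covers the detour through `startWᵖ`, which sets the accumulator to 0.
mergeW-budget : ∀ r s → 10 + budget (suc (r + s)) ≤ 400 * suc (r + s)
mergeW-budget r s = begin
  10 + budget (suc (r + s))          ≡⟨ cong (10 +_) (budget≡ _) ⟩
  10 + 100 * suc (r + s)             ≤⟨ +-monoˡ-≤ (100 * suc (r + s)) (≤-trans (≤ᵇ⇒≤ 10 (300 * 1) tt) (ℕ.*-monoʳ-≤ 300 (s≤s (z≤n {r + s})))) ⟩
  300 * suc (r + s) + 100 * suc (r + s) ≡⟨ ℕ.*-distribʳ-+ (suc (r + s)) 300 100 ⟨
  400 * suc (r + s)                  ∎
  where open ℕ.≤-Reasoning

-- The bound of `loop-run` for `K` equal to 400 and `n` blocks of one item each.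
sortBudget : ℕ → ℕ
sortBudget n = suc ⌈log₂ n ⌉ * (400 + 2 * 400 * suc (n + n))

-- Insertions and their effect on the marker.

module Insertion {n : ℕ} (I : Instance n) where
  open Instance I
  open Density I
  open Procedures I


  insertᵐ : Fin n → List (Maybe (Fin n)) → List (Maybe (Fin n))
  insertᵐ y []      = just y ∷ []
  insertᵐ y (p ∷ X) = ifᵇ p ≻ᵇ just y then p ∷ insertᵐ y X else just y ∷ p ∷ X

  ≻ᵇ-elim : ∀ {i j} → (just i ≻ᵇ just j) ≡ true → i ≻ j
  ≻ᵇ-elim {i} {j} = does-elim (i ≻? j)

  ⊁ᵇ-elim : ∀ {i j} → (just i ≻ᵇ just j) ≡ false → ¬ i ≻ j
  ⊁ᵇ-elim {i} {j} eq i≻j with () ← trans (sym (dec-true (i ≻? j) i≻j)) eq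

  ≻ᵇ-trans : ∀ p b {y} → p ≻ᵇ b ≡ true → b ≻ᵇ just y ≡ true → p ≻ᵇ just y ≡ true
  ≻ᵇ-trans nothing  b        _ _ = refl
  ≻ᵇ-trans (just p) (just b) {y} e f = dec-true (p ≻? y) (≻-trans (≻ᵇ-elim e) (≻ᵇ-elim f))

  ≻ᵇ-⊁ᵇ-trans : ∀ p b {y} → p ≻ᵇ just y ≡ true → b ≻ᵇ just y ≡ false → p ≻ᵇ b ≡ true
  ≻ᵇ-⊁ᵇ-trans nothing  b        _ _ = refl
  ≻ᵇ-⊁ᵇ-trans (just p) (just b) e f = dec-true (p ≻? b) (≻-⊁-trans (≻ᵇ-elim e) (⊁ᵇ-elim f))

  true≢false : ∀ {b} → b ≡ true → b ≡ false → ∀ {A : Set} → A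
  true≢false refl ()

  merge-[] : ∀ X → merge X [] ≡ X
  merge-[] []      = refl
  merge-[] (p ∷ X) = cong (p ∷_) (merge-[] X)

  -- No sortedness is assumed: only the heads `p`, `b` and the new item `y` matter. Of the eight
  -- outcomes of their comparisons, transitivity excludes p ≻ b ≻ y without p ≻ y, and negative
  -- transitivity excludes p ≻ y with neither p ≻ b nor b ≻ y; in all others both sides emit the
  -- same item first.
  insert-merge : ∀ y X B → insertᵐ y (merge X B) ≡ merge X (insertᵐ y B)
  insert-merge y []      B  = refl
  insert-merge y (p ∷ X) [] with ih ← insert-merge y X [] | p ≻ᵇ just y
  ... | true  = cong (p ∷_) ih
  ... | false = refl
  insert-merge y (p ∷ X) (b ∷ B)
    with ih₁ ← insert-merge y X (b ∷ B) | ih₂ ← insert-merge y (p ∷ X) B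
    = split (p ≻ᵇ b) (p ≻ᵇ just y) (b ≻ᵇ just y) refl refl refl
    where
    split : ∀ pb py by → p ≻ᵇ b ≡ pb → p ≻ᵇ just y ≡ py → b ≻ᵇ just y ≡ by →
            insertᵐ y (merge (p ∷ X) (b ∷ B)) ≡ merge (p ∷ X) (insertᵐ y (b ∷ B))
    split true  true  true  pb py by rewrite pb | py | ih₁ | by | pb = refl
    split true  true  false pb py by rewrite pb | py | ih₁ | by | py = refl
    split true  false true  pb py by = true≢false (≻ᵇ-trans p b pb by) py
    split true  false false pb py by rewrite pb | py | by | py | pb = refl
    split false _     true  pb py by rewrite pb | by | ih₂ | pb = refl
    split false true  false pb py by = true≢false (≻ᵇ-⊁ᵇ-trans p b py by) pb
    split false false false pb py by rewrite pb | by | py | pb = refl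

  -- In front of the marker of `Y`, both sides make the same comparisons. The marker itself is
  -- passed over, and from there on `insert-merge` applies.
  insert-absorb : ∀ y X Y → insertᵐ y (absorb X Y) ≡ absorb X (insertᵐ y Y)
  insert-absorb y X []            = refl
  insert-absorb y X (nothing ∷ B) = insert-merge y X B
  insert-absorb y X (just p ∷ Y) with ih ← insert-absorb y X Y | just p ≻ᵇ just y
  ... | true  = cong (just p ∷_) ih
  ... | false = refl

  module _ (sw : Fin n → Bool) where

    put : Fin n → List (Maybe (Fin n)) → List (Maybe (Fin n))
    put x X = ifᵇ sw x then just x ∷ X else insertᵐ x X

    run : List (Fin n) → List (Maybe (Fin n)) → List (Maybe (Fin n))
    run []      X = X
    run (x ∷ S) X = run S (put x X)

    run-++ : ∀ R S X → run (R ++ S) X ≡ run S (run R X)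
    run-++ []      S X = refl
    run-++ (x ∷ R) S X = run-++ R S (put x X)

    put-absorb : ∀ x X Y → put x (absorb X Y) ≡ absorb X (put x Y)
    put-absorb x X Y with sw x
    ... | true  = refl
    ... | false = insert-absorb x X Y

    run-absorb : ∀ S X Y → run S (absorb X Y) ≡ absorb X (run S Y)
    run-absorb []      X Y = refl
    run-absorb (x ∷ S) X Y = trans (cong (run S) (put-absorb x X Y)) (run-absorb S X (put x Y))

    -- A run on an unknown X is represented by the run on the marker, which
    -- precedes every item.
    run≡absorb : ∀ S X → run S X ≡ absorb X (run S [ nothing ])
    run≡absorb S X = trans (cong (run S) (sym (merge-[] X))) (run-absorb S X [ nothing ])

    length-insertᵐ : ∀ x X → length (insertᵐ x X) ≡ suc (length X)
    length-insertᵐ x []      = refl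
    length-insertᵐ x (p ∷ X) with ih ← length-insertᵐ x X | p ≻ᵇ just x
    ... | true  = cong suc ih
    ... | false = refl

    length-put : ∀ x X → length (put x X) ≡ suc (length X)
    length-put x X with sw x
    ... | true  = refl
    ... | false = length-insertᵐ x X

    length-run : ∀ S X → length (run S X) ≡ length S + length X
    length-run []      X = refl
    length-run (x ∷ S) X = trans (length-run S (put x X)) (trans (cong (length S +_) (length-put x X)) (+-suc (length S) (length X)))

    module _ (ω : Fin n → ℚ) where

      Block : List (Fin n) → Value → Set
      Block S x = x ≡ marks ω (run S [ nothing ])

      -- Running `S` after `R` means running it on the sequence that `R` makes of the marker, so
      -- `run≡absorb` composes the effects. The result has one entry per item besides the marker,
      -- whence the lower bound.
      absorb-block : ∀ {R S x y} → Block R x → Block S y →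
        ∃[ z ] Block (R ++ S) z × absorbᵖ ⟨ cons x y ⟩⇓ z [ length R + length S , 400 * suc (length R + length S) ]
      absorb-block {R} {S} refl refl =
        let c , r , lo , hi = absorb-run ω (run R [ nothing ]) (run S [ nothing ]) in
        _ , cong (marks ω) (sym run≡) , c , r ,
        ≤-trans (≤-trans (m≤m+n _ 1) (≤-reflexive (sym length≡))) lo ,
        ≤-trans hi (subst₂ (λ r s → budget (suc (r + s)) ≤ 400 * suc (length R + length S))
          (sym (length-run R [ nothing ])) (sym (length-run S [ nothing ])) (absorb-budget (length R) (length S)))
        where
        run≡ : run (R ++ S) [ nothing ] ≡ absorb (run R [ nothing ]) (run S [ nothing ])
        run≡ = trans (run-++ R S [ nothing ]) (run≡absorb S (run R [ nothing ]))

        length≡ : length (absorb (run R [ nothing ]) (run S [ nothing ])) ≡ length R + length S + 1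
        length≡ = trans (cong length (sym run≡))
          (trans (length-run (R ++ S) [ nothing ]) (cong (_+ 1) (length-++ R)))

      open DivideAndConquer Block absorbᵖ passᵖ loopᵖ (cons nil nil) refl refl
             (cons nil nil) refl 400 (≤ᵇ⇒≤ _ _ tt) (λ {R} {S} → absorb-block {R} {S})

      leaf-block : ∀ i → Block [ i ] (marks ω (leaf (sw i) i))
      leaf-block i with sw i
      ... | true  = refl
      ... | false = refl

      insertion-run : ∀ L → loopᵖ ⟨ list (map (λ i → marks ω (leaf (sw i) i)) L) ⟩⇓ marks ω (run L [ nothing ])
                      [ length L * ⌈log₂ length L ⌉ , sortBudget (length L) ]
      insertion-run L
        with _ , refl , r ← loop-run (Pointwise-singletons leaf-block L) (<-wellFounded _)
        rewrite concat-map-[ L ] | length-map [_] L = r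

  -- The marker precedes every item, so an insertion passes over it as if it were absent.
  catMaybes-insertᵐ : ∀ x X → catMaybes (insertᵐ x X) ≡ insert I x (catMaybes X)
  catMaybes-insertᵐ x []            = refl
  catMaybes-insertᵐ x (nothing ∷ X) = catMaybes-insertᵐ x X
  catMaybes-insertᵐ x (just p ∷ X) with ih ← catMaybes-insertᵐ x X | p ≻? x
  ... | yes p≻x rewrite dec-true (p ≻? x) p≻x = cong (p ∷_) ih
  ... | no p⊁x rewrite dec-false (p ≻? x) p⊁x = refl

  run-steps : ∀ {sw} L X → All (λ x → Reflects (IsSwapItem I x) (sw x)) L →
              Steps I (catMaybes X) L (catMaybes (run sw L X))
  run-steps []      X []       = done
  run-steps {sw} (x ∷ L) X (r ∷ rs) = step (put-step r) (run-steps L (put sw x X) rs)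
    where
    put-step : Reflects (IsSwapItem I x) (sw x) → Step I x (catMaybes X) (catMaybes (put sw x X))
    put-step r with sw x
    put-step (ofʸ is)  | true  = front is
    put-step (ofⁿ isn) | false = subst (Step I x (catMaybes X)) (sym (catMaybes-insertᵐ x X)) (place isn)

  insertᵐ-↭ : ∀ x X → insertᵐ x X ↭ just x ∷ X
  insertᵐ-↭ x []      = ↭-refl
  insertᵐ-↭ x (p ∷ X) with ih ← insertᵐ-↭ x X | p ≻ᵇ just x
  ... | true  = ↭-trans (prep p ih) (Perm.swap p (just x) ↭-refl)
  ... | false = ↭-refl

  put-↭ : ∀ sw x X → put sw x X ↭ just x ∷ X
  put-↭ sw x X with sw x
  ... | true  = ↭-refl
  ... | false = insertᵐ-↭ x X

  run-↭ : ∀ sw L X → catMaybes (run sw L X) ↭ L ++ catMaybes X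
  run-↭ sw []      X = ↭-refl
  run-↭ sw (x ∷ L) X =
    ↭-trans (run-↭ sw L (put sw x X))
      (↭-trans (++⁺ (↭-refl {x = L}) (catMaybes-↭ (put-↭ sw x X))) (shift x L (catMaybes X)))

  -- The weak form of the order, which insertion preserves without distinctness of the items.
  _⊁ʳ_ : Fin n → Fin n → Set
  i ⊁ʳ j = ¬ j ≻ i

  insertᵐ-sorted : ∀ y X → AllPairs _⊁ʳ_ (catMaybes X) → AllPairs _⊁ʳ_ (catMaybes (insertᵐ y X))
  insertᵐ-sorted y []            _ = [] ∷ []
  insertᵐ-sorted y (nothing ∷ X) s = insertᵐ-sorted y X s
  insertᵐ-sorted y (just p ∷ X) (p⊁ ∷ s) with ih ← insertᵐ-sorted y X s | p ≻? y
  ... | yes p≻y rewrite dec-true (p ≻? y) p≻y =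
    All-resp-↭ (↭-sym (catMaybes-↭ (insertᵐ-↭ y X))) ((λ y≻p → ≻-irrefl (≻-trans y≻p p≻y)) ∷ p⊁) ∷ ih
  ... | no p⊁y rewrite dec-false (p ≻? y) p⊁y =
    (p⊁y ∷ All.map (λ j⊁p j≻y → j⊁p (≻-⊁-trans j≻y p⊁y)) p⊁) ∷ p⊁ ∷ s

  run-sorted : ∀ L X → AllPairs _⊁ʳ_ (catMaybes X) → AllPairs _⊁ʳ_ (catMaybes (run (λ _ → false) L X))
  run-sorted []      X s = s
  run-sorted (x ∷ L) X s = run-sorted L (insertᵐ x X) (insertᵐ-sorted x X s)

  densityOrder : List (Fin n)
  densityOrder = catMaybes (run (λ _ → false) (allFin n) [ nothing ])

  densityOrder-↭ : densityOrder ↭ allFin n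
  densityOrder-↭ = subst (densityOrder ↭_) (++-identityʳ (allFin n)) (run-↭ (λ _ → false) (allFin n) [ nothing ])

  -- As a permutation of `allFin n` the list has distinct entries, and on these the weak order is
  -- strict by `≻-connex`.
  densityOrder-sorted : AllPairs _≻_ densityOrder
  densityOrder-sorted = AllPairs.zipWith (λ (i≢j , i⊁ʳj) → ≻-connex (i≢j ∘ sym) i⊁ʳj)
    (Unique-resp-↭ (setoid (Fin n)) (↭⇒↭ₛ (↭-sym densityOrder-↭)) (allFin⁺ n) , run-sorted (allFin n) [ nothing ] [])

-- Computing the weights by a merge sort by size.

module Weights {n : ℕ} (I : Instance n) where
  open Instance I
  open Density I
  open Procedures I

  items : List (Fin n × ℚ) → List (Fin n)
  items = map proj₁

  lightIn : List (Fin n) → Fin n → List (Fin n)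
  lightIn S i = filter (λ j → l j ℚ.≤? l i) S

  mergeW-↭ : ∀ a xs ys → items (mergeW a xs ys) ↭ items xs ++ items ys
  mergeW-↭ a []             []             = ↭-refl
  mergeW-↭ a []             ((y , w) ∷ ys) = prep y (mergeW-↭ a [] ys)
  mergeW-↭ a (x ∷ xs)       []             = prep (proj₁ x) (mergeW-↭ a xs [])
  mergeW-↭ a ((x , u) ∷ xs) ((y , w) ∷ ys)
    with ih₁ ← mergeW-↭ (a ℚ.+ v x) xs ((y , w) ∷ ys) | ih₂ ← mergeW-↭ a ((x , u) ∷ xs) ys | l x ℚ.≤? l y
  ... | yes x≤y rewrite dec-true (l x ℚ.≤? l y) x≤y = prep x ih₁
  ... | no x≰y rewrite dec-false (l x ℚ.≤? l y) x≰y =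
    ↭-trans (prep y ih₂) (↭-sym (shift y (x ∷ items xs) (items ys)))

  SizeSorted : List (Fin n) → Set
  SizeSorted = AllPairs (λ i j → l i ℚ.≤ l j)

  mergeW-sorted : ∀ a xs ys → SizeSorted (items xs) → SizeSorted (items ys) → SizeSorted (items (mergeW a xs ys))
  mergeW-sorted a []             []             _        _        = []
  mergeW-sorted a []             ((y , w) ∷ ys) p        (y≤ ∷ q) =
    All-resp-↭ (↭-sym (mergeW-↭ a [] ys)) y≤ ∷ mergeW-sorted a [] ys p q
  mergeW-sorted a (x ∷ xs)       []             (x≤ ∷ p) q        =
    All-resp-↭ (↭-sym (mergeW-↭ a xs [])) (All.++⁺ x≤ []) ∷ mergeW-sorted a xs [] p q
  mergeW-sorted a ((x , u) ∷ xs) ((y , w) ∷ ys) (x≤ ∷ p) (y≤ ∷ q)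
    with ih₁ ← mergeW-sorted (a ℚ.+ v x) xs ((y , w) ∷ ys) p (y≤ ∷ q)
       | ih₂ ← mergeW-sorted a ((x , u) ∷ xs) ys (x≤ ∷ p) q | l x ℚ.≤? l y
  ... | yes x≤y rewrite dec-true (l x ℚ.≤? l y) x≤y =
    All-resp-↭ (↭-sym (mergeW-↭ (a ℚ.+ v x) xs ((y , w) ∷ ys))) (All.++⁺ x≤ (x≤y ∷ All.map (ℚ.≤-trans x≤y) y≤)) ∷ ih₁
  ... | no x≰y rewrite dec-false (l x ℚ.≤? l y) x≰y =
    All-resp-↭ (↭-sym (mergeW-↭ a ((x , u) ∷ xs) ys)) (y≤x ∷ All.++⁺ (All.map (ℚ.≤-trans y≤x) x≤) y≤) ∷ ih₂
    where y≤x = ℚ.<⇒≤ (ℚ.≰⇒> x≰y)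

  -- The accumulator a is the value of the items of the left list that have
  -- already been emitted.
  mergeW-weights : ∀ (P : Fin n → ℚ → Set) a xs ys → SizeSorted (items xs) → SizeSorted (items ys) →
                   All (λ (x , u) → P x u) xs →
                   All (λ (y , w) → P y (w ℚ.+ (a ℚ.+ total v (lightIn (items xs) y)))) ys →
                   All (λ (z , w) → P z w) (mergeW a xs ys)
  mergeW-weights P a [] [] _ _ _ _ = []
  mergeW-weights P a [] ((y , w) ∷ ys) p (y≤ ∷ q) ps (r ∷ rs) =
    subst (λ b → P y (w ℚ.+ b)) (ℚ.+-identityʳ a) r ∷ mergeW-weights P a [] ys p q ps rs
  mergeW-weights P a ((x , u) ∷ xs) [] (x≤ ∷ p) q (pr ∷ ps) _ = pr ∷ mergeW-weights P a xs [] p q ps []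
  mergeW-weights P a ((x , u) ∷ xs) ((y , w) ∷ ys) (x≤ ∷ p) (y≤ ∷ q) (pr ∷ ps) (r ∷ rs)
    with ih₁ ← mergeW-weights P (a ℚ.+ v x) xs ((y , w) ∷ ys) p (y≤ ∷ q) ps
       | ih₂ ← mergeW-weights P a ((x , u) ∷ xs) ys (x≤ ∷ p) q (pr ∷ ps) rs
    = split (l x ℚ.≤? l y)
    where
    -- Emitting `x` moves its value from the sum over the left list into the accumulator.
    emit : ∀ z w → l x ℚ.≤ l z → P z (w ℚ.+ (a ℚ.+ total v (lightIn (x ∷ items xs) z))) →
           P z (w ℚ.+ (a ℚ.+ v x ℚ.+ total v (lightIn (items xs) z)))
    emit z w x≤z = subst (λ b → P z (w ℚ.+ b))
      (trans (cong (λ S → a ℚ.+ total v S) (filter-accept (λ j → l j ℚ.≤? l z) x≤z)) (sym (ℚ.+-assoc a (v x) _)))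

    emitted : l x ℚ.≤ l y → All (λ (z , w) → P z w) (mergeW (a ℚ.+ v x) xs ((y , w) ∷ ys))
    emitted x≤y = ih₁ (emit y w x≤y r ∷
      All.zipWith (λ {(z , w)} (x≤z , r) → emit z w x≤z r) (All.map (ℚ.≤-trans x≤y) (All.map⁻ y≤) , rs))

    -- The left list is sorted by size, so with `x` all its remaining items are larger than `y`: the
    -- accumulator is complete for `y`.
    skipped : ¬ l x ℚ.≤ l y → P y (w ℚ.+ a)
    skipped x≰y = subst (λ b → P y (w ℚ.+ b))
      (trans (cong (λ S → a ℚ.+ total v S) (filter-none (λ j → l j ℚ.≤? l y)
               (x≰y ∷ All.map (λ x≤z z≤y → x≰y (ℚ.≤-trans x≤z z≤y)) x≤)))
             (ℚ.+-identityʳ a)) r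

    split : Dec (l x ℚ.≤ l y) → All (λ (z , w) → P z w) (mergeW a ((x , u) ∷ xs) ((y , w) ∷ ys))
    split (yes x≤y) with e ← emitted x≤y rewrite dec-true (l x ℚ.≤? l y) x≤y = pr ∷ e
    split (no x≰y)  with s ← skipped x≰y rewrite dec-false (l x ℚ.≤? l y) x≰y = s ∷ ih₂

  -- The claim on the weights is conditional on `S` being in density order, because blocks of
  -- arbitrary segments must be joinable; the order of a concatenation passes to its parts.
  Block : List (Fin n) → Value → Set
  Block S z = ∃[ zs ] z ≡ weights zs × items zs ↭ S × SizeSorted (items zs) ×
              (AllPairs _≻_ S → All (λ (i , w) → w ≡ precedingValue S i) zs)

  -- If R ++ S is in density order, no item of `S` precedes one of `R`, so the weights of `R` are
  -- final. Every item of `R` precedes every item of `S`, so a weight in `S` grows by the value of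
  -- all items of `R` that are not larger.
  mergeW-block : ∀ {R S x y} → Block R x → Block S y →
    ∃[ z ] Block (R ++ S) z × startWᵖ ⟨ cons x y ⟩⇓ z [ length R + length S , 400 * suc (length R + length S) ]
  mergeW-block {R} {S} (xs , refl , xs↭ , xs-sorted , xs-ok) (ys , refl , ys↭ , ys-sorted , ys-ok) =
    let c , r , lo , hi = startW-run xs ys in
    _ , (mergeW 0ℚ xs ys , refl , ↭-trans (mergeW-↭ 0ℚ xs ys) (++⁺ xs↭ ys↭) ,
         mergeW-sorted 0ℚ xs ys xs-sorted ys-sorted , ok) ,
    c , r ,
    ≤-trans (≤-reflexive (trans (sym (length-++ R)) length≡)) lo ,
    ≤-trans hi affordable
    where
    |xs|≡ : length xs ≡ length R
    |xs|≡ = trans (sym (length-map proj₁ xs)) (↭-length xs↭)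

    |ys|≡ : length ys ≡ length S
    |ys|≡ = trans (sym (length-map proj₁ ys)) (↭-length ys↭)

    affordable : 10 + budget (suc (length xs + length ys)) ≤ 400 * suc (length R + length S)
    affordable rewrite sym |xs|≡ | sym |ys|≡ = mergeW-budget (length xs) (length ys)

    length≡ : length (R ++ S) ≡ length (mergeW 0ℚ xs ys)
    length≡ = trans (↭-length (↭-sym (↭-trans (mergeW-↭ 0ℚ xs ys) (++⁺ xs↭ ys↭)))) (length-map proj₁ (mergeW 0ℚ xs ys))

    ok : AllPairs _≻_ (R ++ S) → All (λ (i , w) → w ≡ precedingValue (R ++ S) i) (mergeW 0ℚ xs ys)
    ok sorted with R-sorted , S-sorted , R≻S ← AllPairs-++⁻ R sorted =
      mergeW-weights (λ i w → w ≡ precedingValue (R ++ S) i) 0ℚ xs ys xs-sorted ys-sorted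
        (All.zipWith (λ { (refl , e) → sym e })
          (xs-ok R-sorted , All.map⁻ (All-resp-↭ (↭-sym xs↭) (All.map inR R≻S))))
        (All.zipWith (λ {(y , w)} (e , R≻y) → inS e R≻y)
          (ys-ok S-sorted , All.map⁻ (All-resp-↭ (↭-sym ys↭) (All.tabulate λ y∈S → All.map (λ i≻S → All.lookup i≻S y∈S) R≻S))))
      where
      inR : ∀ {i} → All (i ≻_) S → precedingValue (R ++ S) i ≡ precedingValue R i
      inR {i} i≻S = trans (precedingValue-++ R S i)
        (trans (cong (λ T → precedingValue R i ℚ.+ total v T)
                 (filter-none (_≻? i) (All.filter⁺ (λ j → l j ℚ.≤? l i) (All.map (λ i≻j j≻i → ≻-irrefl (≻-trans i≻j j≻i)) i≻S))))
               (ℚ.+-identityʳ _))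

      inS : ∀ {i w} → w ≡ precedingValue S i → All (_≻ i) R →
            w ℚ.+ (0ℚ ℚ.+ total v (lightIn (items xs) i)) ≡ precedingValue (R ++ S) i
      inS {i} refl R≻i = begin
        precedingValue S i ℚ.+ (0ℚ ℚ.+ total v (lightIn (items xs) i)) ≡⟨ cong (precedingValue S i ℚ.+_) (ℚ.+-identityˡ _) ⟩
        precedingValue S i ℚ.+ total v (lightIn (items xs) i)  ≡⟨ cong (precedingValue S i ℚ.+_) (total-↭ v (filter-↭ _ xs↭)) ⟩
        precedingValue S i ℚ.+ total v (lightIn R i)           ≡⟨ cong (λ T → precedingValue S i ℚ.+ total v T) (filter-all (_≻? i) (All.filter⁺ (λ j → l j ℚ.≤? l i) R≻i)) ⟨
        precedingValue S i ℚ.+ precedingValue R i              ≡⟨ ℚ.+-comm (precedingValue S i) _ ⟩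
        precedingValue R i ℚ.+ precedingValue S i              ≡⟨ precedingValue-++ R S i ⟨
        precedingValue (R ++ S) i                              ∎
        where open ≡-Reasoning

  single-block : ∀ i → Block [ i ] (weights [ i , 0ℚ ])
  single-block i = [ i , 0ℚ ] , refl , ↭-refl , [] ∷ [] , λ _ → sym precedes-nothing ∷ []
    where
    precedes-nothing : precedingValue [ i ] i ≡ 0ℚ
    precedes-nothing = cong (total v) (filter-none (_≻? i) (All.filter⁺ (λ j → l j ℚ.≤? l i) (≻-irrefl ∷ [])))

  open DivideAndConquer Block startWᵖ passWᵖ loopWᵖ nil refl refl nil ([] , refl , ↭-refl , [] , λ _ → [])
         400 (≤ᵇ⇒≤ _ _ tt) (λ {R} {S} → mergeW-block {R} {S})

  weights-run : ∀ S → ∃[ zs ] items zs ↭ S × SizeSorted (items zs) ×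
                (AllPairs _≻_ S → All (λ (i , w) → w ≡ precedingValue S i) zs) ×
                loopWᵖ ⟨ list (map (λ i → weights [ i , 0ℚ ]) S) ⟩⇓ weights zs
                [ length S * ⌈log₂ length S ⌉ , sortBudget (length S) ]
  weights-run S with _ , (zs , refl , zs↭ , sorted , ok) , r ← loop-run (Pointwise-singletons single-block S) (<-wellFounded _)
    rewrite concat-map-[ S ] | length-map [_] S = zs , zs↭ , sorted , ok , r

-- Running time

⌊log₂⌋-suc : ∀ k → ⌊log₂ 2 + k ⌋ ≡ suc ⌊log₂ ⌊ 2 + k /2⌋ ⌋
⌊log₂⌋-suc k =
  trans (sym (ℕ.m+[n∸m]≡n (⌊log₂⌋-mono-≤ {2} {2 + k} (s≤s (s≤s z≤n)))))
        (cong suc (sym (⌊log₂⌊n/2⌋⌋≡⌊log₂n⌋∸1 (2 + k))))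

-- The form with `suc n` reproduces itself under halving: ⌈(1 + n)/2⌉ = 1 + ⌊n/2⌋.
⌈log₂1+n⌉≤1+⌊log₂n⌋ : ∀ n → Acc _<_ n → ⌈log₂ suc n ⌉ ≤ suc ⌊log₂ n ⌋
⌈log₂1+n⌉≤1+⌊log₂n⌋ zero          _       = z≤n
⌈log₂1+n⌉≤1+⌊log₂n⌋ (suc zero)    _       = s≤s z≤n
⌈log₂1+n⌉≤1+⌊log₂n⌋ (suc (suc k)) (acc r) = begin
  ⌈log₂ 3 + k ⌉                     ≡⟨ ⌈log₂⌉-suc (suc k) ⟩
  suc ⌈log₂ suc ⌊ 2 + k /2⌋ ⌉       ≤⟨ s≤s (⌈log₂1+n⌉≤1+⌊log₂n⌋ ⌊ 2 + k /2⌋ (r (ℕ.⌊n/2⌋<n (suc k)))) ⟩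
  2 + ⌊log₂ ⌊ 2 + k /2⌋ ⌋           ≡⟨ cong suc (⌊log₂⌋-suc k) ⟨
  suc ⌊log₂ 2 + k ⌋                 ∎
  where open ℕ.≤-Reasoning

⌈log₂n⌉≤1+⌊log₂n⌋ : ∀ n → ⌈log₂ n ⌉ ≤ suc ⌊log₂ n ⌋
⌈log₂n⌉≤1+⌊log₂n⌋ n = ≤-trans (⌈log₂⌉-mono-≤ (n≤1+n n)) (⌈log₂1+n⌉≤1+⌊log₂n⌋ n (<-wellFounded n))

⌊log₂n⌋≤⌈log₂n⌉ : ∀ n → Acc _<_ n → ⌊log₂ n ⌋ ≤ ⌈log₂ n ⌉
⌊log₂n⌋≤⌈log₂n⌉ zero          _       = z≤n
⌊log₂n⌋≤⌈log₂n⌉ (suc zero)    _       = z≤n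
⌊log₂n⌋≤⌈log₂n⌉ (suc (suc k)) (acc r) = begin
  ⌊log₂ 2 + k ⌋               ≡⟨ ⌊log₂⌋-suc k ⟩
  suc ⌊log₂ ⌊ 2 + k /2⌋ ⌋     ≤⟨ s≤s (⌊log₂n⌋≤⌈log₂n⌉ ⌊ 2 + k /2⌋ (r (ℕ.⌊n/2⌋<n (suc k)))) ⟩
  suc ⌈log₂ ⌊ 2 + k /2⌋ ⌉     ≤⟨ s≤s (⌈log₂⌉-mono-≤ (ℕ.⌊n/2⌋≤⌈n/2⌉ (2 + k))) ⟩
  suc ⌈log₂ ⌈ 2 + k /2⌉ ⌉     ≡⟨ ⌈log₂⌉-suc k ⟨
  ⌈log₂ 2 + k ⌉               ∎
  where open ℕ.≤-Reasoning

-- For `wrapᵖ`, `singlesᵖ`, `classifyᵖ` and `indicesᵖ`; the second and the fourth read lists that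
-- contain the marker.
linearBudget : ℕ → ℕ
linearBudget n = budget (suc n) + budget (suc (suc n)) + (budget (suc n) + budget (suc (suc n)))

-- The 8 counts the seven calls in `main` and the access to the input; the three sorts are by
-- density, by size, and the insertions.
universalBudget : ℕ → ℕ
universalBudget n = 8 + (linearBudget n + 3 * sortBudget n)

-- From n = 2 on, m = ⌊log₂ n⌋ is at least 1, so constants and multiples of n are absorbed by n m. A
-- sort costs at most 3 m times 2800 n, and 26008 = 8 + 800 + 3 · 8400.
universalBudget≤ : ∀ n → 2 ≤ n → universalBudget n ≤ 26008 * (n * ⌊log₂ n ⌋)
universalBudget≤ n 2≤n = begin
  8 + (linearBudget n + 3 * sortBudget n)
    ≤⟨ ℕ.+-mono-≤ (scale 8 1≤nm) (ℕ.+-mono-≤ linear (ℕ.*-monoʳ-≤ 3 sort)) ⟩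
  8 * nm + (800 * nm + 3 * (8400 * nm))     ≡⟨ collect nm ⟩
  26008 * nm                                ∎
  where
  open ℕ.≤-Reasoning
  m = ⌊log₂ n ⌋
  nm = n * m

  1≤n : 1 ≤ n
  1≤n = ≤-trans (n≤1+n 1) 2≤n

  1≤m : 1 ≤ m
  1≤m = ⌊log₂⌋-mono-≤ {2} 2≤n

  n≤nm : n ≤ nm
  n≤nm = subst (_≤ nm) (ℕ.*-identityʳ n) (ℕ.*-monoʳ-≤ n 1≤m)

  1≤nm : 1 ≤ nm
  1≤nm = ≤-trans 1≤n n≤nm

  scale : ∀ k {j} → 1 ≤ j → k ≤ k * j
  scale k {j} 1≤j = subst (_≤ k * j) (ℕ.*-identityʳ k) (ℕ.*-monoʳ-≤ k 1≤j)

  budget≤ : ∀ {j} → j ≤ 2 + n → budget j ≤ 200 * nm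
  budget≤ {j} j≤2+n = begin
    budget j          ≡⟨ budget≡ j ⟩
    100 * j           ≤⟨ ℕ.*-monoʳ-≤ 100 (≤-trans j≤2+n (+-monoˡ-≤ n 2≤n)) ⟩
    100 * (n + n)     ≡⟨ cong (100 *_) (cong (n +_) (ℕ.+-identityʳ n)) ⟨
    100 * (2 * n)     ≡⟨ ℕ.*-assoc 100 2 n ⟨
    200 * n           ≤⟨ ℕ.*-monoʳ-≤ 200 n≤nm ⟩
    200 * nm          ∎

  linear : linearBudget n ≤ 800 * nm
  linear = begin
    linearBudget n
      ≤⟨ ℕ.+-mono-≤ (ℕ.+-mono-≤ (budget≤ (n≤1+n _)) (budget≤ ≤-refl)) (ℕ.+-mono-≤ (budget≤ (n≤1+n _)) (budget≤ ≤-refl)) ⟩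
    200 * nm + 200 * nm + (200 * nm + 200 * nm)   ≡⟨ double 200 200 ⟩
    800 * nm ∎
    where
    double : ∀ j k → j * nm + j * nm + (k * nm + k * nm) ≡ (j + j + (k + k)) * nm
    double j k = sym (trans (ℕ.*-distribʳ-+ nm (j + j) (k + k)) (cong₂ _+_ (ℕ.*-distribʳ-+ nm j j) (ℕ.*-distribʳ-+ nm k k)))

  sort : sortBudget n ≤ 8400 * nm
  sort = begin
    suc ⌈log₂ n ⌉ * (400 + 800 * suc (n + n))
      ≤⟨ ℕ.*-mono-≤ (s≤s (⌈log₂n⌉≤1+⌊log₂n⌋ n)) once ⟩
    (2 + m) * (400 * n + 800 * (n + (n + n)))     ≤⟨ ℕ.*-mono-≤ (+-monoˡ-≤ m (scale 2 1≤m)) ≤-refl ⟩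
    (2 * m + m) * (400 * n + 800 * (n + (n + n))) ≡⟨ cong₂ _*_ (triple m) (septuple n) ⟩
    (3 * m) * (2800 * n)                          ≡⟨ rearrange 3 m 2800 n ⟩
    8400 * nm                                     ∎
    where
    once : 400 + 800 * suc (n + n) ≤ 400 * n + 800 * (n + (n + n))
    once = ℕ.+-mono-≤ {400} {400 * n} (scale 400 1≤n) (ℕ.*-monoʳ-≤ 800 (+-monoˡ-≤ (n + n) 1≤n))

    triple : ∀ m → 2 * m + m ≡ 3 * m
    triple = solve-∀
    septuple : ∀ n → 400 * n + 800 * (n + (n + n)) ≡ 2800 * n
    septuple n = trans (cong (λ k → 400 * n + 800 * k) (lemma n))
      (trans (cong (400 * n +_) (sym (ℕ.*-assoc 800 3 n))) (sym (ℕ.*-distribʳ-+ n 400 2400)))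
      where
      lemma : ∀ n → n + (n + n) ≡ 3 * n
      lemma = solve-∀
    rearrange : ∀ a m b n → (a * m) * (b * n) ≡ (a * b) * (n * m)
    rearrange = solve-∀

  collect : ∀ x → 8 * x + (800 * x + 3 * (8400 * x)) ≡ 26008 * x
  collect x = trans (cong (λ y → 8 * x + (800 * x + y)) (sym (ℕ.*-assoc 3 8400 x)))
    (trans (cong (8 * x +_) (sym (ℕ.*-distribʳ-+ x 800 25200))) (sym (ℕ.*-distribʳ-+ x 8 26000)))

-- The lower bound is taken from the sort by density alone. The upper bound is grouped, down to the
-- final 0, as `universalBudget` unfolds.
main-run : ∀ {u x₁ x₂ x₃ x₄ x₅ x₆ x₇ a₁ a₂ a₃ a₄ a₅ a₆ a₇ b₁ b₂ b₃ b₄ b₅ b₆ b₇} →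
           wrapᵖ     ⟨ u  ⟩⇓ x₁ [ a₁ , b₁ ] →
           loopᵖ     ⟨ x₁ ⟩⇓ x₂ [ a₂ , b₂ ] →
           singlesᵖ  ⟨ x₂ ⟩⇓ x₃ [ a₃ , b₃ ] →
           loopWᵖ    ⟨ x₃ ⟩⇓ x₄ [ a₄ , b₄ ] →
           classifyᵖ ⟨ x₄ ⟩⇓ x₅ [ a₅ , b₅ ] →
           loopᵖ     ⟨ x₅ ⟩⇓ x₆ [ a₆ , b₆ ] →
           indicesᵖ  ⟨ x₆ ⟩⇓ x₇ [ a₇ , b₇ ] →
           ∃[ T ] universalᵖ , u ∷ [] ⊢ main universalᵖ ⇓ x₇ [ T ] × a₂ ≤ T ×
                  T ≤ 8 + ((b₁ + b₃ + (b₅ + b₇)) + (b₂ + (b₄ + (b₆ + 0))))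
main-run {a₂ = a₂} {b₁ = b₁} {b₂} {b₃} {b₄} {b₅} {b₆} {b₇}
  (c₁ , r₁ , _ , h₁) (c₂ , r₂ , a₂≤c₂ , h₂) (c₃ , r₃ , _ , h₃) (c₄ , r₄ , _ , h₄)
  (c₅ , r₅ , _ , h₅) (c₆ , r₆ , _ , h₆) (c₇ , r₇ , _ , h₇) =
  T , call (call (call (call (call (call (call var r₁) r₂) r₃) r₄) r₅) r₆) r₇ , lo , hi
  where
  open ℕ.≤-Reasoning
  T = suc (suc (suc (suc (suc (suc (suc (1 + c₁) + c₂) + c₃) + c₄) + c₅) + c₆) + c₇)

  regroup : ∀ c₁ c₂ c₃ c₄ c₅ c₆ c₇ →
            8 + c₁ + c₂ + c₃ + c₄ + c₅ + c₆ + c₇ ≡ 8 + ((c₁ + c₃ + (c₅ + c₇)) + (c₂ + (c₄ + (c₆ + 0))))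
  regroup = solve-∀

  lo : a₂ ≤ T
  lo = begin
    a₂                                                 ≤⟨ a₂≤c₂ ⟩
    c₂                                                 ≤⟨ m≤m+n c₂ _ ⟩
    c₂ + (c₄ + (c₆ + 0))                               ≤⟨ m≤n+m _ (8 + (c₁ + c₃ + (c₅ + c₇))) ⟩
    8 + (c₁ + c₃ + (c₅ + c₇)) + (c₂ + (c₄ + (c₆ + 0))) ≡⟨ regroup c₁ c₂ c₃ c₄ c₅ c₆ c₇ ⟨
    T                                                  ∎

  hi : T ≤ 8 + ((b₁ + b₃ + (b₅ + b₇)) + (b₂ + (b₄ + (b₆ + 0))))
  hi = begin
    T                                                     ≡⟨ regroup c₁ c₂ c₃ c₄ c₅ c₆ c₇ ⟩
    8 + ((c₁ + c₃ + (c₅ + c₇)) + (c₂ + (c₄ + (c₆ + 0))))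
      ≤⟨ +-monoʳ-≤ 8 (ℕ.+-mono-≤ (ℕ.+-mono-≤ (ℕ.+-mono-≤ h₁ h₃) (ℕ.+-mono-≤ h₅ h₇))
           (ℕ.+-mono-≤ h₂ (ℕ.+-mono-≤ h₄ (+-monoˡ-≤ 0 h₆)))) ⟩
    8 + ((b₁ + b₃ + (b₅ + b₇)) + (b₂ + (b₄ + (b₆ + 0))))  ∎

-- The run of the whole program on an instance.

module _ {n : ℕ} (I : Instance n) where
  open Instance I
  open Density I
  open Procedures I
  open Insertion I
  open Weights I using (items; SizeSorted; weights-run)

  isSwapWeight-reflects : ∀ i → Reflects (IsSwapItem I i) (isSwapWeight i (precedingValue densityOrder i))
  -- The `does` of the product decision reduces to the conjunction that defines `isSwapWeight`.
  isSwapWeight-reflects i = proof (map′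
    (λ (0<w , w<v) → swapItem⁺ densityOrder-↭ densityOrder-sorted 0<w w<v)
    (swapItem⁻ densityOrder-↭)
    ((0ℚ ℚ.<? precedingValue densityOrder i) ×-dec (precedingValue densityOrder i ℚ.<? v i)))

  -- From here on, weights are a function of the items, which is the form `classify-run` and the
  -- second insertion phase take.
  annotated : ∀ {ω : Fin n → ℚ} zs → All (λ (i , w) → w ≡ ω i) zs → zs ≡ map (λ i → i , ω i) (items zs)
  annotated []             []           = refl
  annotated ((i , _) ∷ zs) (refl ∷ eqs) = cong ((i , _) ∷_) (annotated zs eqs)

  length≡ : ∀ {L} → L ↭ allFin n → length L ≡ n
  length≡ L↭ = trans (↭-length L↭) (length-tabulate (λ i → i))

  length-run≡ : ∀ sw {L} → L ↭ allFin n → length (run sw L [ nothing ]) ≡ suc n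
  length-run≡ sw {L} L↭ = trans (length-run sw L [ nothing ]) (trans (+-comm (length L) 1) (cong suc (length≡ L↭)))

  linear : ∀ {A : ℕ → Set} {j k} → j ≡ k →
           ∃[ c ] A c × 0 ≤ c × c ≤ budget (suc j) → ∃[ c ] A c × 0 ≤ c × c ≤ budget (suc k)
  linear refl r = r

  sorting : ∀ {A : ℕ → Set} {j k} → j ≡ k →
            ∃[ c ] A c × j * ⌈log₂ j ⌉ ≤ c × c ≤ sortBudget j → ∃[ c ] A c × k * ⌈log₂ k ⌉ ≤ c × c ≤ sortBudget k
  sorting refl r = r

  module _ (L : List (Fin n)) (L↭ : L ↭ allFin n) (L-sorted : Linked (λ i j → l i ℚ.≤ l j) L) where

    ω : Fin n → ℚ
    ω = precedingValue densityOrder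

    isSwap : Fin n → Bool
    isSwap i = isSwapWeight i (ω i)

    X : List (Maybe (Fin n))
    X = run isSwap L [ nothing ]

    policy : IsPolicy (catMaybes X)
    policy = ↭-trans (subst (catMaybes X ↭_) (++-identityʳ L) (run-↭ isSwap L [ nothing ])) L↭

    universal : Universal I (catMaybes X)
    universal = L , L↭ , L-sorted , run-steps L [ nothing ] (All.universal isSwapWeight-reflects L)

    classified : ∀ {zs} → items zs ≡ L → All (λ (i , w) → w ≡ ω i) zs →
                 classifyᵖ ⟨ weights zs ⟩⇓ list (map (λ i → marks ω (leaf (isSwap i) i)) L) [ 0 , budget (suc n) ]
    classified {zs} refl ok = subst (λ zs′ → classifyᵖ ⟨ weights zs′ ⟩⇓ list (map (λ i → marks ω (leaf (isSwap i) i)) (items zs)) [ 0 , budget (suc n) ]) (sym (annotated zs ok))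
      (linear (length≡ L↭) (classify-run ω L))

    pipeline : ∀ {zs} → items zs ≡ L → All (λ (i , w) → w ≡ ω i) zs →
               loopWᵖ ⟨ list (map (λ i → weights [ i , 0ℚ ]) densityOrder) ⟩⇓ weights zs
                 [ length densityOrder * ⌈log₂ length densityOrder ⌉ , sortBudget (length densityOrder) ] →
               ∃[ T ] Run universalᵖ I (encodePolicy (catMaybes X)) T × n * ⌈log₂ n ⌉ ≤ T × T ≤ universalBudget n
    pipeline L≡ ok r = main-run
      (linear (length≡ ↭-refl) (wrap-run (allFin n)))
      (sorting (length≡ ↭-refl) (insertion-run (λ _ → false) (λ _ → 0ℚ) (allFin n)))
      (linear (length-run≡ (λ _ → false) ↭-refl) (singles-run (run (λ _ → false) (allFin n) [ nothing ])))
      (sorting (length≡ densityOrder-↭) r)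
      (classified L≡ ok)
      (sorting (length≡ L↭) (insertion-run isSwap ω L))
      (linear (length-run≡ isSwap L↭) (indices-run ω X))

  UniversalRun : Set
  UniversalRun = ∃[ Π ] ∃[ T ] Run universalᵖ I (encodePolicy Π) T × IsPolicy Π × Universal I Π ×
                 n * ⌈log₂ n ⌉ ≤ T × T ≤ universalBudget n

  universal-run : UniversalRun
  universal-run = use (weights-run densityOrder)
    where
    use : _ → UniversalRun
    use (zs , zs↭ , zs-sorted , zs-weights , r) =
      package (pipeline (items zs) L↭ L-sorted refl (zs-weights densityOrder-sorted) r)
      where
      L↭ = ↭-trans zs↭ densityOrder-↭
      L-sorted = AllPairs⇒Linked zs-sorted
      package : _ → UniversalRun
      package (T , r , lo , hi) = _ , T , r , policy (items zs) L↭ L-sorted , universal (items zs) L↭ L-sorted , lo , hi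

-- A sample instance suffices for the lower bound, since `universal-run` bounds the cost from below
-- on every instance.
unitInstance : ∀ n → Instance n
unitInstance n = record
  { v   = λ _ → 0ℚ
  ; l   = λ _ → 1ℚ
  ; v≥0 = λ _ → ℚ.≤-refl
  ; l>0 = λ _ → _
  ; tie = ⤖-id (Fin n)
  }

theorem7 : ∃[ p ] ImplementsUniversal p × RunsInΘ p (λ n → n * ⌊log₂ n ⌋)
theorem7 = universalᵖ , implements , 1 , 26008 , 2 , λ n 2≤n → upper n 2≤n , lower n
  where
  implements : ImplementsUniversal universalᵖ
  implements n I =
    let Π , T , r , policy , universal , _ = universal-run I in Π , T , r , policy , universal

  upper : ∀ n → 2 ≤ n → (I : Instance n) → ∀ w T → Run universalᵖ I w T → T ≤ 26008 * (n * ⌊log₂ n ⌋)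
  upper n 2≤n I w T r =
    let _ , T′ , r′ , _ , _ , _ , hi = universal-run I in
    -- By determinism, the given run has the cost of the constructed one.
    subst (_≤ 26008 * (n * ⌊log₂ n ⌋)) (proj₂ (⇓-deterministic r′ r)) (≤-trans hi (universalBudget≤ n 2≤n))

  lower : ∀ n → ∃[ I ] ∃[ w ] ∃[ T ] Run {n} universalᵖ I w T × n * ⌊log₂ n ⌋ ≤ 1 * T
  lower n =
    let _ , T , r , _ , _ , lo , _ = universal-run (unitInstance n) in
    unitInstance n , _ , T , r ,
    ≤-trans (ℕ.*-monoʳ-≤ n (⌊log₂n⌋≤⌈log₂n⌉ n (<-wellFounded n))) (≤-trans lo (≤-reflexive (sym (ℕ.*-identityˡ T))))
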